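{- Let $n\ge1$, let $\mathcal{T}_n$ be an $n$-periodic triangulation of the strip $\mathcal{U}_n$ with associated $n$-arithmetic frieze $\mathcal{F}_{\mathcal{T}_n}=(m_{ij})_{j-i\ge -2}$. Then (for all $i,j\in\mathbb{Z}$ with $j-i\ge-2$ and any $k\in\mathbb{Z}$) $$m_{ij}=n_{(i-1)^{(k)}}\!\left((j+1)^{(k)}\right).$$
   Context: Infinite friezes: an infinite frieze is an array $(m_{ij})_{i,j\in\mathbb{Z},\,j-i\ge -2}$ of integers with $m_{i,i-2}=0$, $m_{i,i-1}=1$ for all $i$, $m_{ij}>0$ for all $j\ge i$, and $m_{ij}m_{i+1,j+1}-m_{i+1,j}m_{i,j+1}=1$ for all $j-i\ge -1$. It is $n$-periodic if $m_{ij}=m_{i+n,j+n}$ for all $i\le j$; its quiddity sequence is then $(m_{11},\dots,m_{nn})$, which determines it. Strip: $\mathcal{U}_n$ is $\mathbb{R}\times$ (closed interval) with vertices $0^{(k)}$, $k\in\mathbb{Z}$, on the upper boundary and vertices $1^{(k)},\dots,n^{(k)}$, $k\in\mathbb{Z}$, on the lower boundary, ordered from left to right on the lower boundary by: $i^{(k)}\le j^{(l)}$ iff $k<l$, or $k=l$ and $i\le j$; the vertices $0^{(k)}$ are ordered from left to right by $k$, with $0^{(k)}$ above $1^{(k)},\dots,n^{(k)}$. Convention: $(i+ln)^{(k)}=i^{(k+l)}$ for $1\le i\le n$, $l\in\mathbb{Z}$, so $i^{(k)}$ makes sense for every $i\in\mathbb{Z}$ as a lower vertex. An arc in $\mathcal{U}_n$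 is (the isotopy class of) a non-self-intersecting curve connecting two vertices such that (A1) at least one vertex is on the lower boundary; (A2) the two vertices are neither equal nor neighbors; (A3) if one vertex is on the upper boundary, the superscripts of the two vertices are equal (so the arcs to the upper boundary are $0^{(k)}j^{(k)}$, $1\le j\le n$). A triangulation of $\mathcal{U}_n$ is a maximal collection of arcs that pairwise do not meet in the interior of $\mathcal{U}_n$; the regions into which it cuts $\mathcal{U}_n$ are called triangles. It is $n$-periodic if it has a fundamental domain: an $(n+3)$-gon $\mathcal{P}$ with vertices $0^{(k)},0^{(k+1)}$ and $i^{(k)},(i+1)^{(k)},\dots,n^{(k)},1^{(k+1)},\dots,i^{(k+1)}$ for some $i\in\{1,\dots,n\}$, $k\in\mathbb{Z}$, bounded on the sides by the arcs $0^{(k)}i^{(k)}$ and $0^{(k+1)}i^{(k+1)}$ of the triangulation, such that the triangulation is covered by the horizontal translates of $\mathcal{P}$ (shifting superscripts by integers). In an $n$-periodic triangulation each triangle is either bounded by three sides, or is a four-sided region with vertices $i^{(k)},i'^{(k+1)},0^{(k)},0^{(k+1)}$ having one side on the upper boundary (such a region also counts as a triangle). Associated frieze: the quiddity sequence of an $n$-periodic triangulation $\mathcal{T}_n$ is $(a_1,\dots,a_n)$, where $a_i$ is the number of triangles of $\mathcal{T}_n$ incident with $i^{(k)}$ (independent of $k$). $\mathcal{F}_{\mathcal{T}_n}$ is the $n$-periodic infinite frieze with $m_{ii}=a_i$ for $1\le i\le n$ (it exists and is $n$-arithmetic, meaning that for all $i\in\mathbb{Z}$ and $k\in\{1,\dots,n\}$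 the difference $m_{i,(i+k-3)+(l+1)n}-m_{i,(i+k-3)+ln}$ is the same for all $l\ge0$). Labels: fix a starting vertex $v$ on the lower boundary. Labels $n_v(w)\in\mathbb{Z}_{\ge0}$ are attached to all vertices $w$ of $\mathcal{U}_n$ as follows. Set $n_v(v)=0$ and $n_v(w)=1$ whenever $w$ is joined with $v$ by a boundary segment or by an arc of $\mathcal{T}_n$ ($w$ may lie on the upper boundary). As soon as one vertex on the upper boundary receives a label, all vertices on the upper boundary receive that same label. Next, iteratively: whenever three lower vertices $w_1,w_2,w_3$ form a triangle of $\mathcal{T}_n$ with $w_1,w_2$ labeled and $w_3$ not, set $n_v(w_3)=n_v(w_1)+n_v(w_2)$. When no such triangle is left, consider triangles of $\mathcal{T}_n$ having two lower vertices and touching the upper boundary, either with vertices $i^{(k)},i'^{(k)},0^{(k)}$ or with vertices $i^{(k)},i'^{(k+1)},0^{(k)},0^{(k+1)}$; in the latter case $0^{(k)}$ and $0^{(k+1)}$ are regarded as one single vertex with a common label. If two of the three (so regarded) vertices are labeled, the remaining one gets the sum of the two labels. Continue in this way with all triangles until all vertices are labeled. -}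

module Defs where

open import Data.Nat.Base as ℕ using (ℕ; NonZero)
open import Data.Integer.Base using (ℤ; +_; -_; _+_; _-_; _*_; _≤_; _<_)
open import Data.Integer.DivMod using (_/ℕ_)
open import Data.Fin.Base using (Fin; toℕ)
open import Data.Unit.Base using (⊤)
open import Data.Empty using (⊥)
open import Data.Product.Base using (∃; ∃-syntax; _×_)
open import Data.Sum.Base using (_⊎_)
open import Data.List.Base using (List; []; _∷_; length)
open import Data.List.Membership.Propositional using (_∈_)
open import Data.List.Relation.Unary.Unique.Propositional using (Unique)
open import Function.Bundles using (_⇔_)
open import Level using (0ℓ)
open import Relation.Binary.Core using (Rel; _⇒_)
open import Relation.Binary.Definitions using (Symmetric; Decidable)
open import Relation.Binary.PropositionalEquality.Core using (_≡_; _≢_)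
open import Relation.Nullary.Negation.Core using (¬_)

------------------------------------------------------------------------
-- Infinite friezes

-- An array is a total function; its entries with j - i < -2 are junk and
-- are never constrained.
record IsInfiniteFrieze (m : ℤ → ℤ → ℤ) : Set where
  field
    zeros    : ∀ i → m i (i - + 2) ≡ + 0
    ones     : ∀ i → m i (i - + 1) ≡ + 1
    positive : ∀ i j → i ≤ j → + 0 < m i j
    diamond  : ∀ i j → - (+ 1) ≤ j - i →
               m i j * m (i + + 1) (j + + 1) - m (i + + 1) j * m i (j + + 1) ≡ + 1

IsPeriodicArray : ℕ → (ℤ → ℤ → ℤ) → Set
IsPeriodicArray n m = ∀ i j → i ≤ j → m i j ≡ m (i + + n) (j + + n)

------------------------------------------------------------------------
-- Vertices of the strip

-- upper k is 0^(k).  The lower vertices are numbered from left to right by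
-- ℤ, the vertex i^(k) (1 ≤ i ≤ n) being lower (i + k n).
data Vertex : Set where
  upper lower : ℤ → Vertex

IsUpper IsLower : Vertex → Set
IsUpper (upper _) = ⊤
IsUpper (lower _) = ⊥
IsLower (upper _) = ⊥
IsLower (lower _) = ⊤

-- The vertex i^(k), for every i ∈ ℤ; thus (i + l n)^(k) = i^(k + l).
lowerVertex : ℕ → ℤ → ℤ → Vertex
lowerVertex n i k = lower (i + k * + n)

-- The k with p = i + k n and 1 ≤ i ≤ n (/ℕ rounds towards -∞).
superscript : (n : ℕ) .{{_ : NonZero n}} → Vertex → ℤ
superscript n (upper k) = k
superscript n (lower p) = (p - + 1) /ℕ n

translate : ℕ → ℤ → Vertex → Vertex
translate n l (upper k) = upper (k + l)
translate n l (lower p) = lower (p + l * + n)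

-- Joined by a boundary segment.
Neighbours : Rel Vertex 0ℓ
Neighbours (upper k) (upper l) = l ≡ k + + 1 ⊎ k ≡ l + + 1
Neighbours (lower p) (lower q) = q ≡ p + + 1 ⊎ p ≡ q + + 1
Neighbours (upper _) (lower _) = ⊥
Neighbours (lower _) (upper _) = ⊥

-- The order in which the vertices are met when running along the lower
-- boundary from left to right and then back along the upper boundary.
_≺_ : Rel Vertex 0ℓ
lower p ≺ lower q = p < q
lower _ ≺ upper _ = ⊤
upper _ ≺ lower _ = ⊥
upper k ≺ upper l = l < k

Cyclic : Vertex → Vertex → Vertex → Set
Cyclic u v w = (u ≺ v × v ≺ w) ⊎ (v ≺ w × w ≺ u) ⊎ (w ≺ u × u ≺ v)

-- The strip is simply connected, so an arc is determined up to isotopy by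
-- its endpoints, and two arcs {u,v}, {x,y} can be drawn without meeting in
-- the interior unless x and y lie strictly on different sides of {u,v}.
Cross : Vertex → Vertex → Vertex → Vertex → Set
Cross u v x y = (Cyclic u x v × Cyclic v y u) ⊎ (Cyclic u y v × Cyclic v x u)

------------------------------------------------------------------------
-- Arcs and triangulations

record IsArc (n : ℕ) .{{_ : NonZero n}} (u v : Vertex) : Set where
  field
    A1 : IsLower u ⊎ IsLower v
    A2 : u ≢ v × ¬ Neighbours u v
    A3 : IsUpper u ⊎ IsUpper v → superscript n u ≡ superscript n v

-- A collection of arcs is a symmetric relation: T u v means that the arc
-- joining u and v belongs to it.
record IsNonCrossing (n : ℕ) .{{_ : NonZero n}} (T : Rel Vertex 0ℓ) : Set where
  field
    symmetric   : Symmetric T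
    arcs        : ∀ {u v} → T u v → IsArc n u v
    nonCrossing : ∀ {u v x y} → T u v → T x y → ¬ Cross u v x y

-- Decidability of membership is automatic classically; constructively it is
-- what allows one to speak of the regions cut out by the arcs.
record IsTriangulation (n : ℕ) .{{_ : NonZero n}} (T : Rel Vertex 0ℓ) : Set₁ where
  field
    _∈?_          : Decidable T
    isNonCrossing : IsNonCrossing n T
    maximal       : ∀ (S : Rel Vertex 0ℓ) → IsNonCrossing n S → T ⇒ S → S ⇒ T

-- The vertices of the (n+3)-gon with corners 0^(k), 0^(k+1), i^(k), i^(k+1).
InPolygon : (n : ℕ) (i k : ℤ) → Vertex → Set
InPolygon n i k (upper l) = l ≡ k ⊎ l ≡ k + + 1
InPolygon n i k (lower p) = i + k * + n ≤ p × p ≤ i + (k + + 1) * + n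

record IsFundamentalDomain (n : ℕ) (T : Rel Vertex 0ℓ) (i k : ℤ) : Set where
  field
    leftSide  : T (upper k) (lowerVertex n i k)
    rightSide : T (upper (k + + 1)) (lowerVertex n i (k + + 1))
    -- T is the union of the translates of its part inside the polygon.
    covers    : ∀ u v → T u v ⇔
                (∃[ l ] ∃[ u′ ] ∃[ v′ ]
                  InPolygon n i k u′ × InPolygon n i k v′ × T u′ v′ ×
                  u ≡ translate n l u′ × v ≡ translate n l v′)

record IsPeriodicTriangulation (n : ℕ) .{{_ : NonZero n}} (T : Rel Vertex 0ℓ) : Set₁ where
  field
    isTriangulation   : IsTriangulation n T
    fundamentalDomain : ∃[ i ] ∃[ k ]
                        + 1 ≤ i × i ≤ + n × IsFundamentalDomain n T i k

------------------------------------------------------------------------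
-- Triangles

Side : Rel Vertex 0ℓ → Rel Vertex 0ℓ
Side T u v = Neighbours u v ⊎ T u v

-- The three possible kinds of regions, given by their vertices:
--   lll p q r : lower p, lower q, lower r
--   llu p q k : lower p, lower q, 0^(k)
--   lluu p q k : lower p, lower q, 0^(k), 0^(k+1), with a side on the upper
--                boundary
data Region : Set where
  lll llu lluu : ℤ → ℤ → ℤ → Region

-- The lower vertices are listed from left to right, so that every triangle
-- is represented by exactly one region.  All vertices lie on the boundary and
-- 0^(k) is joined by arcs to vertices with superscript k only, so nothing in
-- T can cut the regions below any further.
IsTriangle : Rel Vertex 0ℓ → Region → Set
IsTriangle T (lll p q r) =
  p < q × q < r ×
  Side T (lower p) (lower q) × Side T (lower q) (lower r) × Side T (lower p) (lower r)
IsTriangle T (llu p q k) =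
  p < q ×
  Side T (lower p) (lower q) × T (upper k) (lower p) × T (upper k) (lower q)
IsTriangle T (lluu p q k) =
  p < q ×
  Side T (lower p) (lower q) × T (upper k) (lower p) × T (upper (k + + 1)) (lower q)

vertices : Region → List Vertex
vertices (lll p q r)  = lower p ∷ lower q ∷ lower r ∷ []
vertices (llu p q k)  = lower p ∷ lower q ∷ upper k ∷ []
vertices (lluu p q k) = lower p ∷ lower q ∷ upper k ∷ upper (k + + 1) ∷ []

NumberOfTrianglesAt : Rel Vertex 0ℓ → Vertex → ℕ → Set
NumberOfTrianglesAt T v c =
  ∃[ Rs ] Unique Rs × length Rs ≡ c ×
          (∀ R → R ∈ Rs ⇔ (IsTriangle T R × v ∈ vertices R))

------------------------------------------------------------------------
-- The associated frieze

-- The index set {1, …, n}.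
index : {n : ℕ} → Fin n → ℤ
index i = + ℕ.suc (toℕ i)

IsQuiddity : (n : ℕ) → Rel Vertex 0ℓ → (Fin n → ℕ) → Set
IsQuiddity n T a = ∀ i k → NumberOfTrianglesAt T (lowerVertex n (index i) k) (a i)

record IsAssociatedFrieze (n : ℕ) (T : Rel Vertex 0ℓ) (m : ℤ → ℤ → ℤ) : Set where
  field
    isInfiniteFrieze : IsInfiniteFrieze m
    isPeriodic       : IsPeriodicArray n m
    quiddity         : Fin n → ℕ
    isQuiddity       : IsQuiddity n T quiddity
    diagonal         : ∀ i → m (index i) (index i) ≡ + quiddity i

------------------------------------------------------------------------
-- Labels

-- A stage of the labelling procedure: L w x means that w carries the label x.
PartialLabelling : Set₁
PartialLabelling = Vertex → ℕ → Set

Labelled : PartialLabelling → Vertex → Set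
Labelled L w = ∃ (L w)

-- All upper vertices are labelled simultaneously and alike.
_≈_ : Rel Vertex 0ℓ
upper _ ≈ upper _ = ⊤
lower p ≈ lower q = p ≡ q
upper _ ≈ lower _ = ⊥
lower _ ≈ upper _ = ⊥

data Initial (T : Rel Vertex 0ℓ) (v : Vertex) : PartialLabelling where
  self   : Initial T v v 0
  joined : ∀ {u w} → Side T v w → u ≈ w → Initial T v u 1

data _[_↦_] (L : PartialLabelling) (w : Vertex) (x : ℕ) : PartialLabelling where
  old : ∀ {u y} → L u y → (L [ w ↦ x ]) u y
  new : ∀ {u} → u ≈ w → (L [ w ↦ x ]) u x

-- Corners R w₁ w₂ w₃: the three corners of R are w₁, w₂, w₃, up to the order
-- of w₁ and w₂ (which is irrelevant since labels are added).  In a four-sided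
-- region 0^(k) and 0^(k+1) count as one corner; they always carry the same
-- label, so 0^(k) stands for both.
data Corners : Region → Vertex → Vertex → Vertex → Set where
  lll₁  : ∀ {p q r} → Corners (lll p q r) (lower q) (lower r) (lower p)
  lll₂  : ∀ {p q r} → Corners (lll p q r) (lower p) (lower r) (lower q)
  lll₃  : ∀ {p q r} → Corners (lll p q r) (lower p) (lower q) (lower r)
  llu₁  : ∀ {p q k} → Corners (llu p q k) (lower q) (upper k) (lower p)
  llu₂  : ∀ {p q k} → Corners (llu p q k) (lower p) (upper k) (lower q)
  llu₃  : ∀ {p q k} → Corners (llu p q k) (lower p) (lower q) (upper k)
  lluu₁ : ∀ {p q k} → Corners (lluu p q k) (lower q) (upper k) (lower p)
  lluu₂ : ∀ {p q k} → Corners (lluu p q k) (lower p) (upper k) (lower q)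
  lluu₃ : ∀ {p q k} → Corners (lluu p q k) (lower p) (lower q) (upper k)

-- Triangle R allows w₃, not yet labelled, to receive the label x.
data Applicable (T : Rel Vertex 0ℓ) (L : PartialLabelling) (R : Region) :
                Vertex → ℕ → Set where
  sum : ∀ {w₁ w₂ w₃ x₁ x₂} → IsTriangle T R → Corners R w₁ w₂ w₃ →
        L w₁ x₁ → L w₂ x₂ → ¬ Labelled L w₃ →
        Applicable T L R w₃ (x₁ ℕ.+ x₂)

data IsLowerRegion : Region → Set where
  isLower : ∀ {p q r} → IsLowerRegion (lll p q r)

-- In the first phase only triangles with three lower vertices are used; it
-- ends when none of them is applicable any more.  Afterwards all triangles
-- are used.
data Phase : Set where
  lowerTriangles allTriangles : Phase

-- Reached T v φ L: started at v, the procedure can arrive, after finitely many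
-- steps and in phase φ, at the partial labelling L.
data Reached (T : Rel Vertex 0ℓ) (v : Vertex) : Phase → PartialLabelling → Set₁ where
  start     : Reached T v lowerTriangles (Initial T v)
  lowerStep : ∀ {L R w x} → Reached T v lowerTriangles L →
              IsLowerRegion R → Applicable T L R w x →
              Reached T v lowerTriangles (L [ w ↦ x ])
  switch    : ∀ {L} → Reached T v lowerTriangles L →
              (∀ {R w x} → IsLowerRegion R → ¬ Applicable T L R w x) →
              Reached T v allTriangles L
  step      : ∀ {L R w x} → Reached T v allTriangles L →
              Applicable T L R w x →
              Reached T v allTriangles (L [ w ↦ x ])

-- n_v(w) = x.  The procedure leaves the order of the steps open, so this says
-- that w does receive a label and that it is x whatever choices are made.
record LabelIs (T : Rel Vertex 0ℓ) (v w : Vertex) (x : ℕ) : Set₁ where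
  field
    received : ∃[ φ ] ∃[ L ] Reached T v φ L × L w x
    unique   : ∀ {φ L y} → Reached T v φ L → L w y → y ≡ x

{-# OPTIONS --safe #-}
module Submission where

-- Fix a lower vertex v and let g be the solution of
-- g (p + 1) + g (p - 1) = a_p g p with g v = 0 and g (v + 1) = 1, where a_p is
-- the number of triangles at p.  The diamond rule implies this recurrence for
-- the rows of the frieze, so g w = m (v + 1) (w - 1) for w ≥ v.
--
-- Expressing a_p through the triangles in the polygons cut off on either side
-- of p shows, by induction on these polygons, that g q = g p + g r in every
-- triangle p < q < r of lower vertices, and that g b′ - g b is the same for any
-- two consecutive vertices b < b′ joined to the upper boundary.  Taking this
-- difference as the value at the upper boundary, the values at the corners of
-- every triangle satisfy value q = value p + value r, and after a change of
-- sign to the left of v the corner opposite the side facing v gets the sum of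
-- the other two.  The labelling procedure uses every triangle in this way,
-- since a label crosses a side only after both ends of it are labelled.

open import Defs
open import Data.Nat.Base as ℕ using (ℕ; NonZero)
import Data.Nat.Properties as ℕₚ
open import Data.Integer.Base as ℤ using (ℤ; +_; -[1+_]; -_; _+_; _-_; _*_; _≤_; _<_; +<+; +≤+; ∣_∣)
open import Data.Integer.Properties
open import Data.Integer.DivMod using (_/ℕ_; _%ℕ_; [n/ℕd]*d≤n; n<s[n/ℕd]*d; a≡a%ℕn+[a/ℕn]*n; n%ℕd<d)
open import Data.Integer.Tactic.RingSolver using (solve-∀)
open import Data.Fin.Base using (fromℕ<)
open import Data.Fin.Properties using (toℕ-fromℕ<)
open import Data.Empty using (⊥; ⊥-elim)
open import Data.Unit.Base using (⊤; tt)
open import Data.Product.Base using (Σ; ∃-syntax; _×_; _,_; proj₁; proj₂)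
open import Data.Sum.Base using (_⊎_; inj₁; inj₂; swap)
open import Function.Base using (_∘_; id)
open import Function.Bundles using (Equivalence; mk⇔)
open import Level using (0ℓ)
open import Data.List.Base using (List; []; _∷_; _++_; length)
open import Data.List.Properties using (length-++)
open import Data.List.Membership.Propositional using (_∈_)
open import Data.List.Membership.Propositional.Properties using (∈-++⁺ˡ; ∈-++⁺ʳ; ∈-++⁻)
open import Data.List.Membership.Propositional.Properties.WithK using (unique∧set⇒bag)
open import Data.List.Relation.Binary.BagAndSetEquality using (∼bag⇒↭)
open import Data.List.Relation.Binary.Permutation.Propositional.Properties using (↭-length)
import Data.List.Relation.Unary.All as All
open import Data.List.Relation.Unary.Any using (here; there)
open import Data.List.Relation.Unary.Unique.Propositional using (Unique; []; _∷_)
open import Data.List.Relation.Unary.Unique.Propositional.Properties using (++⁺)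
import Data.Sum.Base as Sum
open import Relation.Binary.Core using (Rel)
open import Relation.Binary.Definitions using (Tri; tri<; tri≈; tri>)
open import Relation.Binary.PropositionalEquality
open import Relation.Nullary using (¬_; Dec; yes; no)
open import Relation.Nullary.Decidable using (_×-dec_; _⊎-dec_)

-- Integer intervals

-- The frieze axioms say nothing about entries with `j - i < - 2`, yet labels to the left of `v`
-- matter even for a `w` to its right: the upper boundary may receive its label as a sum over two
-- vertices on either side of `v`. This is why `g` is built on all of ℤ from the recurrence alone;
-- run backwards it gives `g (v - 1) = - 1`, the source of the change of sign. A stage of the
-- procedure is only a relation, and any applicable triangle may come next. Hence two separate
-- tasks: an invariant of all reached stages shows that no choice leads to a different label, and
-- one explicit run shows that a label is received. That run has to bring the first phase to an end
-- although the strip contains infinitely many triangles; it can, because arcs to the upper boundary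
-- wall in a finite window of lower vertices around `v`.

i<i+1 : ∀ i → i < i + + 1
i<i+1 i = subst (_< i + + 1) (+-identityʳ i) (+-monoʳ-< i (+<+ (ℕ.s≤s ℕ.z≤n)))

i<j⇒i+1≤j : ∀ {i j} → i < j → i + + 1 ≤ j
i<j⇒i+1≤j {i} {j} lt = subst (_≤ j) (+-comm (+ 1) i) (i<j⇒suc[i]≤j lt)

i<j+1⇒i≤j : ∀ {i j} → i < j + + 1 → i ≤ j
i<j+1⇒i≤j {i} {j} lt = ≮⇒≥ λ j<i → <-irrefl refl (<-≤-trans lt (i<j⇒i+1≤j j<i))

i-1<i : ∀ i → i - + 1 < i
i-1<i i = subst (i - + 1 <_) (lemma i) (i<i+1 (i - + 1))
  where
  lemma : ∀ i → i - + 1 + + 1 ≡ i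
  lemma = solve-∀

i≤j⇒j≡i+d : ∀ {i j} → i ≤ j → ∃[ d ] j ≡ i + + d
i≤j⇒j≡i+d {i} {j} i≤j = ∣ j - i ∣ , (begin
  j               ≡⟨ lemma i j ⟩
  i + (j - i)     ≡⟨ cong (_+_ i) (sym (0≤i⇒+∣i∣≡i (i≤j⇒0≤j-i i≤j))) ⟩
  i + + ∣ j - i ∣ ∎)
  where
  open ≡-Reasoning
  lemma : ∀ i j → j ≡ i + (j - i)
  lemma = solve-∀

i+suc-d : ∀ i d → i + + ℕ.suc d ≡ i + + 1 + + d
i+suc-d i d = sym (+-assoc i (+ 1) (+ d))

abstract

  first : {P : ℤ → Set} → (∀ x → Dec (P x)) → ∀ {p q} → p < q → P q →
          ∃[ b ] p < b × b ≤ q × P b × (∀ {x} → p < x → x < b → ¬ P x)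
  first {P} P? {p} {q} p<q Pq with i≤j⇒j≡i+d (i<j⇒i+1≤j p<q)
  ... | d , refl = search d p Pq
    where
    search : ∀ d p → P (p + + 1 + + d) →
             ∃[ b ] p < b × b ≤ p + + 1 + + d × P b × (∀ {x} → p < x → x < b → ¬ P x)
    search d p Pq with P? (p + + 1)
    ... | yes P1 = p + + 1 , i<i+1 p , i≤i+j (p + + 1) (+ d) , P1 ,
                   λ p<x x<p+1 → ⊥-elim (<⇒≱ x<p+1 (i<j⇒i+1≤j p<x))
    search ℕ.zero p Pq | no ¬P1 = ⊥-elim (¬P1 (subst P (+-identityʳ (p + + 1)) Pq))
    search (ℕ.suc d) p Pq | no ¬P1
      with search d (p + + 1) (subst P (i+suc-d (p + + 1) d) Pq)
    ... | b , p+1<b , b≤ , Pb , min =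
      b , <-trans (i<i+1 p) p+1<b , subst (b ≤_) (sym (i+suc-d (p + + 1) d)) b≤ , Pb , below
      where
      below : ∀ {x} → p < x → x < b → ¬ P x
      below {x} p<x x<b Px with <-cmp (p + + 1) x
      ... | tri< lt _ _ = min lt x<b Px
      ... | tri≈ _ eq _ = ¬P1 (subst P (sym eq) Px)
      ... | tri> _ _ gt = <⇒≱ gt (i<j⇒i+1≤j p<x)

  last : {P : ℤ → Set} → (∀ x → Dec (P x)) → ∀ {p q} → p < q → P p →
         ∃[ b ] b < q × p ≤ b × P b × (∀ {x} → b < x → x < q → ¬ P x)
  last {P} P? {p} {q} p<q Pp
    with first {P ∘ -_} (P? ∘ -_) (neg-mono-< p<q) (subst P (sym (neg-involutive p)) Pp)
  ... | b , -q<b , b≤-p , Pb , min =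
    - b , subst (- b <_) (neg-involutive q) (neg-mono-< -q<b) ,
    subst (_≤ - b) (neg-involutive p) (neg-mono-≤ b≤-p) , Pb ,
    λ {x} -b<x x<q Px → min (neg-mono-< x<q)
      (subst (- x <_) (neg-involutive b) (neg-mono-< -b<x)) (subst P (sym (neg-involutive x)) Px)

-- The cyclic order of the vertices

≺-trans : ∀ u v w → u ≺ v → v ≺ w → u ≺ w
≺-trans (lower _) (lower _) (lower _) p q = <-trans p q
≺-trans (lower _) (lower _) (upper _) _ _ = tt
≺-trans (lower _) (upper _) (upper _) _ _ = tt
≺-trans (upper _) (upper _) (upper _) p q = <-trans q p

≺-irrefl : ∀ u → ¬ u ≺ u
≺-irrefl (lower _) = <-irrefl refl
≺-irrefl (upper _) = <-irrefl refl

¬Cyclicˡ : ∀ u v → ¬ Cyclic u u v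
¬Cyclicˡ u v (inj₁ (uu , _)) = ≺-irrefl u uu
¬Cyclicˡ u v (inj₂ (inj₁ (uv , vu))) = ≺-irrefl u (≺-trans u v u uv vu)
¬Cyclicˡ u v (inj₂ (inj₂ (_ , uu))) = ≺-irrefl u uu

¬Cyclicʳ : ∀ u v → ¬ Cyclic u v v
¬Cyclicʳ u v (inj₁ (_ , vv)) = ≺-irrefl v vv
¬Cyclicʳ u v (inj₂ (inj₁ (vv , _))) = ≺-irrefl v vv
¬Cyclicʳ u v (inj₂ (inj₂ (vu , uv))) = ≺-irrefl u (≺-trans u v u uv vu)

-- The four points alternate around the circle, and reading them off one place later exchanges the
-- roles of the two chords. This makes `Cross` symmetric although its definition singles out one
-- chord.
Cyclic-interleave : ∀ u v x y → Cyclic u x v → Cyclic v y u → Cyclic x v y × Cyclic y u x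
Cyclic-interleave u v x y = go
  where
  tr : ∀ {a b c} → a ≺ b → b ≺ c → a ≺ c
  tr {a} {b} {c} = ≺-trans a b c
  no-loop : ∀ {A : Set} {a b} → a ≺ b → b ≺ a → A
  no-loop {_} {a} ab ba = ⊥-elim (≺-irrefl a (tr ab ba))
  go : Cyclic u x v → Cyclic v y u → Cyclic x v y × Cyclic y u x
  go (inj₁ (ux , xv)) (inj₁ (vy , yu)) = no-loop (tr ux xv) (tr vy yu)
  go (inj₁ (ux , xv)) (inj₂ (inj₁ (yu , uv))) = inj₂ (inj₂ (tr yu ux , xv)) , inj₁ (yu , ux)
  go (inj₁ (ux , xv)) (inj₂ (inj₂ (uv , vy))) = inj₁ (xv , vy) , inj₂ (inj₁ (ux , tr xv vy))
  go (inj₂ (inj₁ (xv , vu))) (inj₁ (vy , yu)) = inj₁ (xv , vy) , inj₂ (inj₂ (tr xv vy , yu))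
  go (inj₂ (inj₁ (xv , vu))) (inj₂ (inj₁ (yu , uv))) = no-loop uv vu
  go (inj₂ (inj₁ (xv , vu))) (inj₂ (inj₂ (uv , vy))) = no-loop uv vu
  go (inj₂ (inj₂ (vu , ux))) (inj₁ (vy , yu)) = inj₂ (inj₁ (vy , tr yu ux)) , inj₁ (yu , ux)
  go (inj₂ (inj₂ (vu , ux))) (inj₂ (inj₁ (yu , uv))) = no-loop uv vu
  go (inj₂ (inj₂ (vu , ux))) (inj₂ (inj₂ (uv , vy))) = no-loop uv vu

Cross-swap : ∀ u v x y → Cross u v x y → Cross v u x y
Cross-swap u v x y (inj₁ (a , b)) = inj₂ (b , a)
Cross-swap u v x y (inj₂ (a , b)) = inj₁ (b , a)

Cross-sym : ∀ u v x y → Cross u v x y → Cross x y u v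
Cross-sym u v x y (inj₁ (a , b)) =
  let c , d = Cyclic-interleave u v x y a b in inj₂ (c , d)
Cross-sym u v x y (inj₂ (a , b)) =
  let c , d = Cyclic-interleave u v y x a b in inj₁ (d , c)

¬Cross-refl : ∀ u v → ¬ Cross u v u v
¬Cross-refl u v (inj₁ (a , _)) = ¬Cyclicˡ u v a
¬Cross-refl u v (inj₂ (a , _)) = ¬Cyclicʳ u v a

-- For a chord between lower vertices one of its two sides is an interval of the linear order, so
-- cyclic conditions turn into inequalities.
lower-chord-separates : ∀ {q r u v} → q < r → Cyclic (lower q) u (lower r) → Cyclic (lower r) v (lower q) →
  (lower q ≺ u × u ≺ lower r) × (v ≺ lower q ⊎ lower r ≺ v)
lower-chord-separates {q} {r} {u} {v} q<r a b = inside a , outside b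
  where
  inside : Cyclic (lower q) u (lower r) → lower q ≺ u × u ≺ lower r
  inside (inj₁ qur) = qur
  inside (inj₂ (inj₁ (_ , r<q))) = ⊥-elim (<-asym q<r r<q)
  inside (inj₂ (inj₂ (r<q , _))) = ⊥-elim (<-asym q<r r<q)
  outside : Cyclic (lower r) v (lower q) → v ≺ lower q ⊎ lower r ≺ v
  outside (inj₁ (rv , vq)) = inj₁ vq
  outside (inj₂ (inj₁ (vq , _))) = inj₁ vq
  outside (inj₂ (inj₂ (_ , rv))) = inj₂ rv

-- The upper vertices, always labelled alike, are collapsed to a single point ∞
-- to the right of all lower ones; triangles of every kind, the four-sided ones
-- included, then become increasing triples a ⊏ b ⊏ c.

data Point : Set where
  fin : ℤ → Point
  ∞   : Point

fin-injective : ∀ {p q} → fin p ≡ fin q → p ≡ q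
fin-injective refl = refl

π : Vertex → Point
π (lower p) = fin p
π (upper _) = ∞

≈⇒π≡ : ∀ u w → u ≈ w → π u ≡ π w
≈⇒π≡ (lower _) (lower _) p≡q = cong fin p≡q
≈⇒π≡ (upper _) (upper _) _   = refl

π≡⇒≈ : ∀ u w → π u ≡ π w → u ≈ w
π≡⇒≈ (lower _) (lower _) eq = fin-injective eq
π≡⇒≈ (upper _) (upper _) _  = tt

infix 4 _⊏_

_⊏_ : Point → Point → Set
fin p ⊏ fin q = p < q
fin _ ⊏ ∞     = ⊤
∞     ⊏ _     = ⊥

⊏-trans : ∀ a b c → a ⊏ b → b ⊏ c → a ⊏ c
⊏-trans (fin _) (fin _) (fin _) p q = <-trans p q
⊏-trans (fin _) (fin _) ∞ _ _ = tt

⊏-irrefl : ∀ a → ¬ a ⊏ a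
⊏-irrefl (fin _) = <-irrefl refl

⊏-asym : ∀ a b → a ⊏ b → ¬ b ⊏ a
⊏-asym a b p q = ⊏-irrefl a (⊏-trans a b a p q)

⊏-cmp : ∀ a b → Tri (a ⊏ b) (a ≡ b) (b ⊏ a)
⊏-cmp (fin p) (fin q) with <-cmp p q
... | tri< lt ne ngt = tri< lt (ne ∘ fin-injective) ngt
... | tri≈ nlt eq ngt = tri≈ nlt (cong fin eq) ngt
... | tri> nlt ne gt = tri> nlt (ne ∘ fin-injective) gt
⊏-cmp (fin _) ∞ = tri< tt (λ ()) λ ()
⊏-cmp ∞ (fin _) = tri> (λ ()) (λ ()) tt
⊏-cmp ∞ ∞ = tri≈ (λ ()) refl λ ()

module Triangulated (n : ℕ) .{{nz : NonZero n}} (T : Rel Vertex 0ℓ)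
                    (periodic : IsPeriodicTriangulation n T) where

  open IsPeriodicTriangulation periodic
  open IsTriangulation isTriangulation
  open IsNonCrossing isNonCrossing

  -- Arcs forced by maximality

  ¬neighbours-around : ∀ {p x q} → p < x → x < q → ¬ Neighbours (lower p) (lower q)
  ¬neighbours-around p<x x<q (inj₁ refl) = <⇒≱ x<q (i<j⇒i+1≤j p<x)
  ¬neighbours-around {p} {x} {q} p<x x<q (inj₂ refl) = <-asym (i<i+1 q) (<-trans p<x x<q)

  -- Maximality in usable form: if no arc leads from strictly inside the chord to strictly outside,
  -- then `T` with the chord adjoined is still noncrossing, so the chord was in `T` already. The
  -- strict bound on `q + 1` keeps the ends from being neighbours, as A2 requires.
  addArc : ∀ {q r} → q + + 1 < r →
           (∀ {u v} → lower q ≺ u × u ≺ lower r → v ≺ lower q ⊎ lower r ≺ v → ¬ T u v) →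
           T (lower q) (lower r)
  addArc {q} {r} q+1<r free = maximal S isNonCrossingS inj₁ (inj₂ (inj₁ (refl , refl)))
    where
    q<r : q < r
    q<r = <-trans (i<i+1 q) q+1<r

    New : Vertex → Vertex → Set
    New u v = (u ≡ lower q × v ≡ lower r) ⊎ (u ≡ lower r × v ≡ lower q)

    S : Rel Vertex 0ℓ
    S u v = T u v ⊎ New u v

    symmetricS : ∀ {u v} → S u v → S v u
    symmetricS (inj₁ t) = inj₁ (symmetric t)
    symmetricS (inj₂ (inj₁ (a , b))) = inj₂ (inj₂ (b , a))
    symmetricS (inj₂ (inj₂ (a , b))) = inj₂ (inj₁ (b , a))

    ¬neighbours : ¬ Neighbours (lower q) (lower r)
    ¬neighbours = ¬neighbours-around (i<i+1 q) q+1<r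

    arcsS : ∀ {u v} → S u v → IsArc n u v
    arcsS (inj₁ t) = arcs t
    arcsS (inj₂ (inj₁ (refl , refl))) = record
      { A1 = inj₁ tt
      ; A2 = (λ { refl → <-irrefl refl q<r }) , ¬neighbours
      ; A3 = λ { (inj₁ ()) ; (inj₂ ()) }
      }
    arcsS (inj₂ (inj₂ (refl , refl))) = record
      { A1 = inj₁ tt
      ; A2 = (λ { refl → <-irrefl refl q<r }) , ¬neighbours ∘ swap
      ; A3 = λ { (inj₁ ()) ; (inj₂ ()) }
      }

    T-free : ∀ {u v} → T u v → ¬ Cross (lower q) (lower r) u v
    T-free t (inj₁ (a , b)) with lower-chord-separates q<r a b
    ... | i , o = free i o t
    T-free t (inj₂ (a , b)) with lower-chord-separates q<r a b
    ... | i , o = free i o (symmetric t)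

    new-free : ∀ {u v x y} → New u v → T x y → ¬ Cross u v x y
    new-free (inj₁ (refl , refl)) t = T-free t
    new-free {x = x} {y} (inj₂ (refl , refl)) t = T-free t ∘ Cross-swap (lower r) (lower q) x y

    new-new-free : ∀ {u v x y} → New u v → New x y → ¬ Cross u v x y
    new-new-free {u} {v} (inj₁ (refl , refl)) (inj₁ (refl , refl)) = ¬Cross-refl u v
    new-new-free {u} {v} (inj₁ (refl , refl)) (inj₂ (refl , refl)) = ¬Cross-refl v u ∘ Cross-swap u v v u
    new-new-free {u} {v} (inj₂ (refl , refl)) (inj₁ (refl , refl)) = ¬Cross-refl v u ∘ Cross-swap u v v u
    new-new-free {u} {v} (inj₂ (refl , refl)) (inj₂ (refl , refl)) = ¬Cross-refl u v

    nonCrossingS : ∀ {u v x y} → S u v → S x y → ¬ Cross u v x y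
    nonCrossingS (inj₁ s) (inj₁ t) = nonCrossing s t
    nonCrossingS {u} {v} {x} {y} (inj₁ s) (inj₂ t) = new-free t s ∘ Cross-sym u v x y
    nonCrossingS (inj₂ s) (inj₁ t) = new-free s t
    nonCrossingS (inj₂ s) (inj₂ t) = new-new-free s t

    isNonCrossingS : IsNonCrossing n S
    isNonCrossingS = record
      { symmetric = symmetricS ; arcs = arcsS ; nonCrossing = nonCrossingS }

  -- Bridging vertices and the sides between points

  -- By A3 the only upper vertex that can be joined to `p` is the one with the superscript of `p`,
  -- so no quantifier over upper vertices is needed and the predicate is decidable.
  Bridging : ℤ → Set
  Bridging p = T (upper (superscript n (lower p))) (lower p)

  bridging? : ∀ p → Dec (Bridging p)
  bridging? p = upper _ ∈? lower p

  arc-superscript : ∀ {k p} → T (upper k) (lower p) → k ≡ superscript n (lower p)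
  arc-superscript t = IsArc.A3 (arcs t) (inj₁ tt)

  arc⇒bridging : ∀ {k p} → T (upper k) (lower p) → Bridging p
  arc⇒bridging {p = p} t = subst (λ l → T (upper l) (lower p)) (arc-superscript t) t

  infix 4 _—_

  -- No side runs from `∞` to itself: segments of the upper boundary collapse to a point, and A1
  -- excludes arcs between upper vertices.
  _—_ : Point → Point → Set
  fin p — fin q = Side T (lower p) (lower q)
  fin p — ∞     = Bridging p
  ∞     — fin p = Bridging p
  ∞     — ∞     = ⊥

  —-sym : ∀ a b → a — b → b — a
  —-sym (fin _) (fin _) (inj₁ nb) = inj₁ (swap nb)
  —-sym (fin _) (fin _) (inj₂ t) = inj₂ (symmetric t)
  —-sym (fin _) ∞ b = b
  —-sym ∞ (fin _) b = b

  arc⇒— : ∀ {u v} → T u v → π u — π v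
  arc⇒— {lower _} {lower _} t = inj₂ t
  arc⇒— {lower _} {upper _} t = arc⇒bridging (symmetric t)
  arc⇒— {upper _} {lower _} t = arc⇒bridging t
  arc⇒— {upper _} {upper _} t with IsArc.A1 (arcs t)
  ... | inj₁ ()
  ... | inj₂ ()

  side⇒— : ∀ {p w} → Side T (lower p) w → fin p — π w
  side⇒— {w = lower _} s = s
  side⇒— (inj₂ t) = arc⇒— t

  side? : ∀ p q → Dec (Side T (lower p) (lower q))
  side? p q = ((q ≟ p + + 1) ⊎-dec (p ≟ q + + 1)) ⊎-dec (lower p ∈? lower q)

  -- Later noncrossing arguments all go through this form. Only `d` can be `∞`, and the upper vertex
  -- behind it, whichever it is, comes after `b`; a boundary segment has no vertex strictly between
  -- its ends.
  —-noncrossing : ∀ a b c d → a ⊏ c → c ⊏ b → b ⊏ d → a — b → c — d → ⊥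
  —-noncrossing (fin a) (fin b) (fin c) d ac cb bd (inj₁ nb) _ = ¬neighbours-around ac cb nb
  —-noncrossing (fin a) (fin b) (fin c) (fin d) ac cb bd (inj₂ _) (inj₁ nb) = ¬neighbours-around cb bd nb
  —-noncrossing (fin a) (fin b) (fin c) (fin d) ac cb bd (inj₂ s) (inj₂ t) =
    nonCrossing s t (inj₁ (inj₁ (ac , cb) , inj₂ (inj₂ (<-trans ac cb , bd))))
  —-noncrossing (fin a) (fin b) (fin c) ∞ ac cb bd (inj₂ s) t =
    nonCrossing s (symmetric t) (inj₁ (inj₁ (ac , cb) , inj₂ (inj₂ (<-trans ac cb , tt))))

  neighbour : ∀ p → Side T (lower p) (lower (p + + 1))
  neighbour p = inj₁ (inj₁ refl)

  -- The apex is the last q before r joined to p; an arc crossing qr would end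
  -- at p or cross pq or pr, so maximality joins q to r.
  apex : ∀ {p r} → p + + 1 < r → Side T (lower p) (lower r) → ∃[ q ] IsTriangle T (lll p q r)
  apex {p} {r} p+1<r pr
    with last (λ x → (p <? x) ×-dec side? p x) p+1<r (i<i+1 p , neighbour p)
  ... | q , q<r , _ , (p<q , pq) , max = q , p<q , q<r , pq , qr (<-cmp (q + + 1) r) , pr
    where
    free : ∀ {u v} → lower q ≺ u × u ≺ lower r → v ≺ lower q ⊎ lower r ≺ v → ¬ T u v
    free {lower x} (q<x , x<r) (inj₂ r≺v) t = beyond r≺v t
      where
      beyond : ∀ {v} → lower r ≺ v → ¬ T (lower x) v
      beyond {lower y} r<y t = —-noncrossing (fin p) (fin r) (fin x) (fin y) (<-trans p<q q<x) x<r r<y pr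
          (inj₂ t)
      beyond {upper y} r<y t = —-noncrossing (fin p) (fin r) (fin x) ∞ (<-trans p<q q<x) x<r tt pr (arc⇒— t)
    free {lower x} {lower y} (q<x , x<r) (inj₁ y<q) t with <-cmp y p
    ... | tri< y<p _ _ =
      —-noncrossing (fin y) (fin x) (fin p) (fin r) y<p (<-trans p<q q<x) x<r (inj₂ (symmetric t)) pr
    ... | tri≈ _ refl _ = max q<x x<r (<-trans p<q q<x , inj₂ (symmetric t))
    ... | tri> _ _ p<y = —-noncrossing (fin p) (fin q) (fin y) (fin x) p<y y<q q<x pq (inj₂ (symmetric t))

    qr : Tri (q + + 1 < r) (q + + 1 ≡ r) (r < q + + 1) → Side T (lower q) (lower r)
    qr (tri< q+1<r _ _) = inj₂ (addArc q+1<r free)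
    qr (tri≈ _ eq _) = inj₁ (inj₁ (sym eq))
    qr (tri> _ _ gt) = ⊥-elim (<⇒≱ q<r (i<j+1⇒i≤j gt))

  -- The dual tree of the triangulated polygon under a chord, with boundary segments as leaves. Both
  -- the counting and the labelling recurse on it.
  data Polygon : ℤ → ℤ → Set where
    edge : ∀ {p} → Polygon p (p + + 1)
    glue : ∀ {p q r} → IsTriangle T (lll p q r) → Polygon p q → Polygon q r → Polygon p r

  polygon : ∀ {p q} → p < q → Side T (lower p) (lower q) → Polygon p q
  polygon {p} {q} p<q pq with i≤j⇒j≡i+d (<⇒≤ p<q)
  ... | d , refl = go d p<q ≤-refl pq
    where
    -- `d` bounds the length of the chord; the apex lies strictly between the ends, so either half
    -- is shorter.
    go : ∀ d {p q} → p < q → q ≤ p + + d → Side T (lower p) (lower q) → Polygon p q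
    go ℕ.zero {p} {q} p<q q≤ _ = ⊥-elim (<⇒≱ p<q (subst (q ≤_) (+-identityʳ p) q≤))
    go (ℕ.suc d) {p} {q} p<q q≤ pq with <-cmp (p + + 1) q
    ... | tri≈ _ refl _ = edge
    ... | tri> _ _ gt = ⊥-elim (<⇒≱ p<q (i<j+1⇒i≤j gt))
    ... | tri< p+1<q _ _ with apex p+1<q pq
    ... | x , t@(p<x , x<q , px , xq , _) =
      glue t (go d p<x (i<j+1⇒i≤j (<-≤-trans x<q (≤-trans q≤ (≤-reflexive shift)))) px)
             (go d x<q (≤-trans q≤ (≤-trans (≤-reflexive (i+suc-d p d)) (+-monoˡ-≤ (+ d) (i<j⇒i+1≤j p<x)))) xq)
      where
      lemma : ∀ p d → p + + 1 + d ≡ p + d + + 1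
      lemma = solve-∀
      shift : p + + ℕ.suc d ≡ p + + d + + 1
      shift = trans (i+suc-d p d) (lemma p (+ d))

  -- Consecutive bridging vertices

  record Consecutive (b b′ : ℤ) : Set where
    field
      ordered : b < b′
      left    : Bridging b
      right   : Bridging b′
      between : ∀ {x} → b < x → x < b′ → ¬ Bridging x

  superscript-mono : ∀ {p q} → p ≤ q → superscript n (lower p) ≤ superscript n (lower q)
  superscript-mono {p} {q} p≤q = ≮⇒≥ λ lt → <⇒≱ (n<s[n/ℕd]*d (q - + 1) n)
    (≤-trans (*-monoʳ-≤-nonNeg (+ n) (i<j⇒suc[i]≤j lt))
      (≤-trans ([n/ℕd]*d≤n (p - + 1) n) (+-monoˡ-≤ (- (+ 1)) p≤q)))

  abstract

    -- The place where the fundamental domain enters: its left side, translated by `k - k₀`. As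
    -- every upper vertex carries an arc, bridging vertices exist arbitrarily far to the left and to
    -- the right.
    bridge : ∀ k → ∃[ b ] T (upper k) (lower b)
    bridge k with fundamentalDomain
    ... | i , k₀ , _ , _ , domain = i + k₀ * + n + (k - k₀) * + n , Equivalence.from (covers _ _)
          (k - k₀ , upper k₀ , lower (i + k₀ * + n) , inj₁ refl , (≤-refl , left≤right) , leftSide ,
           cong upper (lemma k k₀) , refl)
      where
      open IsFundamentalDomain domain
      lemma : ∀ k k₀ → k ≡ k₀ + (k - k₀)
      lemma = solve-∀
      left≤right : i + k₀ * + n ≤ i + (k₀ + + 1) * + n
      left≤right = +-monoʳ-≤ i (*-monoʳ-≤-nonNeg (+ n) (<⇒≤ (i<i+1 k₀)))

    superscript<⇒< : ∀ {p q} → superscript n (lower p) < superscript n (lower q) → p < q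
    superscript<⇒< lt = ≰⇒> λ q≤p → <⇒≱ lt (superscript-mono q≤p)

    bridge-above : ∀ p → ∃[ b ] p < b × Bridging b × superscript n (lower b) ≡ superscript n (lower p) + + 1
    bridge-above p with bridge (superscript n (lower p) + + 1)
    ... | b , t = b , superscript<⇒< (subst (superscript n (lower p) <_) (arc-superscript t) (i<i+1 _)) ,
                  arc⇒bridging t , sym (arc-superscript t)

    bridge-below : ∀ p → ∃[ b ] b < p × Bridging b
    bridge-below p with bridge (superscript n (lower p) - + 1)
    ... | b , t = b , superscript<⇒< (subst (_< superscript n (lower p)) (arc-superscript t) (i-1<i _)) ,
                  arc⇒bridging t

    next : ∀ p → ∃[ b ] p < b × Bridging b × (∀ {x} → p < x → x < b → ¬ Bridging x)
    next p with bridge-above p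
    ... | b₀ , p<b₀ , t , _ with first bridging? p<b₀ t
    ... | b , p<b , _ , bb , min = b , p<b , bb , min

    previous : ∀ p → ∃[ b ] b < p × Bridging b × (∀ {x} → b < x → x < p → ¬ Bridging x)
    previous p with bridge-below p
    ... | b₀ , b₀<p , t with last bridging? b₀<p t
    ... | b , b<p , _ , bb , max = b , b<p , bb , max

  consecutive-next : ∀ {b} → Bridging b → ∃[ b′ ] Consecutive b b′
  consecutive-next {b} bb with next b
  ... | b′ , b<b′ , bb′ , min = b′ , record { ordered = b<b′ ; left = bb ; right = bb′ ; between = min }

  consecutive-previous : ∀ {b} → Bridging b → ∃[ b′ ] Consecutive b′ b
  consecutive-previous {b} bb with previous b
  ... | b′ , b′<b , bb′ , max = b′ , record { ordered = b′<b ; left = bb′ ; right = bb ; between = max }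

  consecutive-around : ∀ {v} → ¬ Bridging v → ∃[ b ] ∃[ b′ ] b < v × v < b′ × Consecutive b b′
  consecutive-around {v} ¬bv with previous v | next v
  ... | b , b<v , bb , max | b′ , v<b′ , bb′ , min =
    b , b′ , b<v , v<b′ , record { ordered = <-trans b<v v<b′ ; left = bb ; right = bb′ ; between = between }
    where
    between : ∀ {x} → b < x → x < b′ → ¬ Bridging x
    between {x} b<x x<b′ with <-cmp x v
    ... | tri< x<v _ _ = max b<x x<v
    ... | tri≈ _ refl _ = ¬bv
    ... | tri> _ _ v<x = min v<x x<b′

  module _ {b b′ : ℤ} (con : Consecutive b b′) where
    open Consecutive con

    -- An arc leaving the interval from `b` to `b′` would cross the arc from `b` or from `b′` to the
    -- upper boundary, or else end on the upper boundary and make an intermediate vertex bridging.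
    consecutive-side : Side T (lower b) (lower b′)
    consecutive-side with <-cmp (b + + 1) b′
    ... | tri≈ _ eq _ = inj₁ (inj₁ (sym eq))
    ... | tri> _ _ gt = ⊥-elim (<⇒≱ ordered (i<j+1⇒i≤j gt))
    ... | tri< b+1<b′ _ _ = inj₂ (addArc b+1<b′ free)
      where
      free : ∀ {u v} → lower b ≺ u × u ≺ lower b′ → v ≺ lower b ⊎ lower b′ ≺ v → ¬ T u v
      free {lower x} {lower y} (b<x , x<b′) (inj₁ y<b) t =
        —-noncrossing (fin y) (fin x) (fin b) ∞ y<b b<x tt (inj₂ (symmetric t)) left
      free {lower x} {lower y} (b<x , x<b′) (inj₂ b′<y) t =
        —-noncrossing (fin x) (fin y) (fin b′) ∞ x<b′ b′<y tt (inj₂ t) right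
      free {lower x} {upper k} (b<x , x<b′) _ t = between b<x x<b′ (arc⇒bridging (symmetric t))

    consecutive-polygon : Polygon b b′
    consecutive-polygon = polygon ordered consecutive-side

  data UpperRegion (p q : ℤ) : Region → Set where
    three-sided : ∀ {k} → UpperRegion p q (llu p q k)
    four-sided  : ∀ {k} → UpperRegion p q (lluu p q k)

  -- The superscript rises by at most one from `b` to `b′`: the upper vertex following that of `b`
  -- has an arc too, which ends to the right of `b` and so not before `b′`.
  upperTriangle : ∀ {b b′} → Consecutive b b′ → ∃[ R ] UpperRegion b b′ R × IsTriangle T R
  upperTriangle {b} {b′} con with superscript n (lower b) ≟ superscript n (lower b′)
  ... | yes eq = llu b b′ _ , three-sided ,
                 Consecutive.ordered con , consecutive-side con , Consecutive.left con ,
                 subst (λ k → T (upper k) (lower b′)) (sym eq) (Consecutive.right con)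
  ... | no neq = lluu b b′ _ , four-sided ,
                 Consecutive.ordered con , consecutive-side con , Consecutive.left con ,
                 subst (λ k → T (upper k) (lower b′)) (≤-antisym upper-bound lower-bound)
                     (Consecutive.right con)
    where
    lower-bound : superscript n (lower b) + + 1 ≤ superscript n (lower b′)
    lower-bound = i<j⇒i+1≤j (≤∧≢⇒< (superscript-mono (<⇒≤ (Consecutive.ordered con))) neq)
    upper-bound : superscript n (lower b′) ≤ superscript n (lower b) + + 1
    upper-bound with bridge-above b
    ... | c , b<c , bc , eq =
      subst (superscript n (lower b′) ≤_) eq (superscript-mono
          (≮⇒≥ λ c<b′ → Consecutive.between con b<c c<b′ bc))

  -- By A3 the superscripts of `p` and `q` determine both the kind of the region and its index; the
  -- mixed cases would give `k = k + 1`.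
  upperTriangle-unique : ∀ {p q R S} → UpperRegion p q R → UpperRegion p q S →
                         IsTriangle T R → IsTriangle T S → R ≡ S
  upperTriangle-unique {p} {q} three-sided three-sided (_ , _ , r , _) (_ , _ , s , _) =
    cong (llu p q) (trans (arc-superscript r) (sym (arc-superscript s)))
  upperTriangle-unique {p} {q} four-sided four-sided (_ , _ , r , _) (_ , _ , s , _) =
    cong (lluu p q) (trans (arc-superscript r) (sym (arc-superscript s)))
  upperTriangle-unique three-sided four-sided (_ , _ , r , r′) (_ , _ , s , s′) =
    ⊥-elim (<-irrefl (trans (trans (arc-superscript s) (sym (arc-superscript r)))
                            (trans (arc-superscript r′) (sym (arc-superscript s′)))) (i<i+1 _))
  upperTriangle-unique four-sided three-sided (_ , _ , r , r′) (_ , _ , s , s′) =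
    ⊥-elim (<-irrefl (trans (trans (arc-superscript r) (sym (arc-superscript s)))
                            (trans (arc-superscript s′) (sym (arc-superscript r′)))) (i<i+1 _))

  -- The arc of a bridging vertex strictly between `p` and `q` would cross the side joining them.
  consecutive-corners : ∀ {p q R} → UpperRegion p q R → IsTriangle T R → Consecutive p q
  consecutive-corners {p} {q} {R} u t = go u t
    where
    make : p < q → Side T (lower p) (lower q) → Bridging p → Bridging q → Consecutive p q
    make p<q pq bp bq = record
      { ordered = p<q ; left = bp ; right = bq
      ; between = λ {x} p<x x<q bx → —-noncrossing (fin p) (fin q) (fin x) ∞ p<x x<q tt pq bx }
    go : UpperRegion p q R → IsTriangle T R → Consecutive p q
    go three-sided (p<q , pq , a , b) = make p<q pq (arc⇒bridging a) (arc⇒bridging b)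
    go four-sided  (p<q , pq , a , b) = make p<q pq (arc⇒bridging a) (arc⇒bridging b)

  consecutive-uniqueʳ : ∀ {p q q′} → Consecutive p q → Consecutive p q′ → q ≡ q′
  consecutive-uniqueʳ {p} {q} {q′} c d with <-cmp q q′
  ... | tri< lt _ _ = ⊥-elim (Consecutive.between d (Consecutive.ordered c) lt (Consecutive.right c))
  ... | tri≈ _ eq _ = eq
  ... | tri> _ _ gt = ⊥-elim (Consecutive.between c (Consecutive.ordered d) gt (Consecutive.right d))

  consecutive-uniqueˡ : ∀ {p p′ q} → Consecutive p q → Consecutive p′ q → p ≡ p′
  consecutive-uniqueˡ {p} {p′} c d with <-cmp p p′
  ... | tri< lt _ _ = ⊥-elim (Consecutive.between c lt (Consecutive.ordered d) (Consecutive.left d))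
  ... | tri≈ _ eq _ = eq
  ... | tri> _ _ gt = ⊥-elim (Consecutive.between d gt (Consecutive.ordered c) (Consecutive.left c))

  -- Counting triangles

  record Enumeration (P : Region → Set) : Set where
    field
      list     : List Region
      unique   : Unique list
      sound    : ∀ {R} → R ∈ list → P R
      complete : ∀ {R} → P R → R ∈ list

  open Enumeration

  size : ∀ {P} → Enumeration P → ℕ
  size E = length (list E)

  none : ∀ {P} → (∀ {R} → ¬ P R) → Enumeration P
  none ¬P = record { list = [] ; unique = [] ; sound = λ () ; complete = ⊥-elim ∘ ¬P }

  insert : ∀ {P Q} S → ¬ P S → Q S → (∀ {R} → P R → Q R) → (∀ {R} → Q R → R ≡ S ⊎ P R) →
           Enumeration P → Enumeration Q
  insert {P} {Q} S ¬PS QS P⇒Q Q⇒ E = record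
    { list     = S ∷ list E
    ; unique   = All.tabulate (λ R∈E S≡R → ¬PS (subst P (sym S≡R) (sound E R∈E))) ∷ unique E
    ; sound    = λ { (here refl) → QS ; (there R∈E) → P⇒Q (sound E R∈E) }
    ; complete = λ q → place (Q⇒ q)
    }
    where
    place : ∀ {R} → R ≡ S ⊎ P R → R ∈ S ∷ list E
    place (inj₁ R≡S) = here R≡S
    place (inj₂ p) = there (complete E p)

  singleton : ∀ S → Enumeration (_≡ S)
  singleton S = record
    { list = S ∷ [] ; unique = All.[] ∷ [] ; sound = λ { (here eq) → eq } ; complete = here }

  union : ∀ {P Q} → (∀ {R} → P R → ¬ Q R) → Enumeration P → Enumeration Q → Enumeration (λ R → P R ⊎ Q R)
  union disjoint E F = record
    { list     = list E ++ list F
    ; unique   = ++⁺ (unique E) (unique F) (λ (e , f) → disjoint (sound E e) (sound F f))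
    ; sound    = λ R∈ → Sum.map (sound E) (sound F) (∈-++⁻ (list E) R∈)
    ; complete = λ { (inj₁ p) → ∈-++⁺ˡ (complete E p) ; (inj₂ q) → ∈-++⁺ʳ (list E) (complete F q) }
    }

  size-union : ∀ {P Q} (disjoint : ∀ {R} → P R → ¬ Q R) (E : Enumeration P) (F : Enumeration Q) →
               size (union {P} {Q} disjoint E F) ≡ size E ℕ.+ size F
  size-union _ E F = length-++ (list E)

  TriangleAt : ℤ → Region → Set
  TriangleAt p R = IsTriangle T R × lower p ∈ vertices R

  -- Two duplicate-free lists with the same members are permutations of each other, so any
  -- enumeration gives the count.
  numberOfTriangles : ∀ {p c P} → NumberOfTrianglesAt T (lower p) c → (E : Enumeration P) →
                      (∀ {R} → P R → TriangleAt p R) → (∀ {R} → TriangleAt p R → P R) → c ≡ size E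
  numberOfTriangles (Rs , unique-Rs , len , spec) E to from = trans (sym len) (↭-length (∼bag⇒↭
    (unique∧set⇒bag unique-Rs (unique E) (λ {R} → mk⇔
      (λ R∈ → complete E (from (Equivalence.to (spec R) R∈)))
      (λ R∈ → Equivalence.from (spec R) (to (sound E R∈)))))))

  -- Fans of triangles at a vertex

  data CornerAt (p : ℤ) : Region → Set where
    lllˡ  : ∀ {a b} → CornerAt p (lll p a b)
    lllᵐ  : ∀ {a b} → CornerAt p (lll a p b)
    lllʳ  : ∀ {a b} → CornerAt p (lll a b p)
    lluˡ  : ∀ {a k} → CornerAt p (llu p a k)
    lluʳ  : ∀ {a k} → CornerAt p (llu a p k)
    lluuˡ : ∀ {a k} → CornerAt p (lluu p a k)
    lluuʳ : ∀ {a k} → CornerAt p (lluu a p k)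

  cornerAt : ∀ {p} R → lower p ∈ vertices R → CornerAt p R
  cornerAt (lll _ _ _) (here refl) = lllˡ
  cornerAt (lll _ _ _) (there (here refl)) = lllᵐ
  cornerAt (lll _ _ _) (there (there (here refl))) = lllʳ
  cornerAt (llu _ _ _) (here refl) = lluˡ
  cornerAt (llu _ _ _) (there (here refl)) = lluʳ
  cornerAt (llu _ _ _) (there (there (here ())))
  cornerAt (lluu _ _ _) (here refl) = lluuˡ
  cornerAt (lluu _ _ _) (there (here refl)) = lluuʳ
  cornerAt (lluu _ _ _) (there (there (here ())))
  cornerAt (lluu _ _ _) (there (there (there (here ()))))

  -- The triangles at `p` in the polygon under the chord from `p` to `q`: `p` being the leftmost
  -- corner, it is enough that the rightmost one does not pass `q`.
  data RightFan (p q : ℤ) : Region → Set where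
    rightFan : ∀ {a b} → IsTriangle T (lll p a b) → b ≤ q → RightFan p q (lll p a b)

  data LeftFan (p q : ℤ) : Region → Set where
    leftFan : ∀ {a b} → IsTriangle T (lll a b q) → p ≤ a → LeftFan p q (lll a b q)

  rightFan-at : ∀ {p q R} → RightFan p q R → TriangleAt p R
  rightFan-at (rightFan t _) = t , here refl

  leftFan-at : ∀ {p q R} → LeftFan p q R → TriangleAt q R
  leftFan-at (leftFan t _) = t , there (there (here refl))

  fans-disjoint : ∀ {p q r R} → LeftFan p q R → ¬ RightFan q r R
  fans-disjoint (leftFan (a<b , b<q , _) _) (rightFan _ _) = <-irrefl refl (<-trans a<b b<q)

  edge-rightFan : ∀ {p R} → ¬ RightFan p (p + + 1) R
  edge-rightFan (rightFan (p<a , a<b , _) b≤) = <⇒≱ a<b (≤-trans b≤ (i<j⇒i+1≤j p<a))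

  edge-leftFan : ∀ {p R} → ¬ LeftFan p (p + + 1) R
  edge-leftFan (leftFan (a<b , b<q , _) p≤a) = <⇒≱ a<b (≤-trans (i<j+1⇒i≤j b<q) p≤a)

  module _ {p q r : ℤ} (t : IsTriangle T (lll p q r)) where

    private
      p<q = proj₁ t
      q<r = proj₁ (proj₂ t)
      pq  = proj₁ (proj₂ (proj₂ t))
      qr  = proj₁ (proj₂ (proj₂ (proj₂ t)))
      pr  = proj₂ (proj₂ (proj₂ (proj₂ t)))

    -- Beyond the fan over `p q` there is only the triangle `p q r` itself; for any other candidate,
    -- a side would cross `p q` or `q r`.
    rightFan-glue : Enumeration (RightFan p q) → Enumeration (RightFan p r)
    rightFan-glue = insert (lll p q r) (λ { (rightFan _ r≤q) → <⇒≱ q<r r≤q }) (rightFan t ≤-refl)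
      (λ { (rightFan s b≤q) → rightFan s (≤-trans b≤q (<⇒≤ q<r)) }) split
      where
      split : ∀ {R} → RightFan p r R → R ≡ lll p q r ⊎ RightFan p q R
      split (rightFan {a} {b} s@(p<a , a<b , pa , ab , pb) b≤r) with <-cmp b q
      ... | tri< b<q _ _ = inj₂ (rightFan s (<⇒≤ b<q))
      ... | tri≈ _ b≡q _ = inj₂ (rightFan s (≤-reflexive b≡q))
      ... | tri> _ _ q<b with <-cmp b r
      ... | tri< b<r _ _ = ⊥-elim (—-noncrossing (fin p) (fin b) (fin q) (fin r) p<q q<b b<r pb qr)
      ... | tri> _ _ r<b = ⊥-elim (<⇒≱ r<b b≤r)
      ... | tri≈ _ refl _ with <-cmp a q
      ... | tri< a<q _ _ = ⊥-elim (—-noncrossing (fin p) (fin q) (fin a) (fin r) p<a a<q q<r pq ab)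
      ... | tri≈ _ refl _ = inj₁ refl
      ... | tri> _ _ q<a = ⊥-elim (—-noncrossing (fin p) (fin a) (fin q) (fin r) p<q q<a a<b pa qr)

    leftFan-glue : Enumeration (LeftFan q r) → Enumeration (LeftFan p r)
    leftFan-glue = insert (lll p q r) (λ { (leftFan _ q≤p) → <⇒≱ p<q q≤p }) (leftFan t ≤-refl)
      (λ { (leftFan s q≤a) → leftFan s (≤-trans (<⇒≤ p<q) q≤a) }) split
      where
      split : ∀ {R} → LeftFan p r R → R ≡ lll p q r ⊎ LeftFan q r R
      split (leftFan {a} {b} s@(a<b , b<r , ab , br , ar) p≤a) with <-cmp a q
      ... | tri> _ _ q<a = inj₂ (leftFan s (<⇒≤ q<a))
      ... | tri≈ _ a≡q _ = inj₂ (leftFan s (≤-reflexive (sym a≡q)))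
      ... | tri< a<q _ _ with <-cmp a p
      ... | tri> _ _ p<a = ⊥-elim (—-noncrossing (fin p) (fin q) (fin a) (fin r) p<a a<q q<r pq ar)
      ... | tri< a<p _ _ = ⊥-elim (<⇒≱ a<p p≤a)
      ... | tri≈ _ refl _ with <-cmp b q
      ... | tri< b<q _ _ = ⊥-elim (—-noncrossing (fin a) (fin q) (fin b) (fin r) a<b b<q q<r pq br)
      ... | tri≈ _ refl _ = inj₁ refl
      ... | tri> _ _ q<b = ⊥-elim (—-noncrossing (fin a) (fin b) (fin q) (fin r) p<q q<b b<r ab qr)

    -- The side `p r` shields `q` from the upper boundary and from all lower vertices outside. A
    -- triangle with `q` as its middle corner must be `p q r`, and the others lie under `p q` or
    -- under `q r`.
    triangles-at-apex : ∀ {R} → TriangleAt q R → R ≡ lll p q r ⊎ LeftFan p q R ⊎ RightFan q r R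
    triangles-at-apex {R} (s , q∈R) = classify (cornerAt R q∈R) s
      where
      upper-free : ∀ {k} → ¬ T (upper k) (lower q)
      upper-free b = —-noncrossing (fin p) (fin r) (fin q) ∞ p<q q<r tt pr (arc⇒bridging b)
      classify : ∀ {R} → CornerAt q R → IsTriangle T R → R ≡ lll p q r ⊎ LeftFan p q R ⊎ RightFan q r R
      classify (lllˡ {a} {b}) s@(q<a , a<b , qa , ab , qb) with b ≤? r
      ... | yes b≤r = inj₂ (inj₂ (rightFan s b≤r))
      ... | no b≰r = ⊥-elim (—-noncrossing (fin p) (fin r) (fin q) (fin b) p<q q<r (≰⇒> b≰r) pr qb)
      classify (lllʳ {a} {b}) s@(a<b , b<q , ab , bq , aq) with p ≤? a
      ... | yes p≤a = inj₂ (inj₁ (leftFan s p≤a))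
      ... | no p≰a = ⊥-elim (—-noncrossing (fin a) (fin q) (fin p) (fin r) (≰⇒> p≰a) p<q q<r aq pr)
      classify (lllᵐ {a} {b}) s@(a<q , q<b , aq , qb , ab) with <-cmp a p
      ... | tri< a<p _ _ = ⊥-elim (—-noncrossing (fin a) (fin q) (fin p) (fin r) a<p p<q q<r aq pr)
      ... | tri> _ _ p<a = ⊥-elim (—-noncrossing (fin p) (fin q) (fin a) (fin b) p<a a<q q<b pq ab)
      ... | tri≈ _ refl _ with <-cmp b r
      ... | tri< b<r _ _ = ⊥-elim (—-noncrossing (fin a) (fin b) (fin q) (fin r) a<q q<b b<r ab qr)
      ... | tri≈ _ refl _ = inj₁ refl
      ... | tri> _ _ r<b = ⊥-elim (—-noncrossing (fin a) (fin r) (fin q) (fin b) p<q q<r r<b pr qb)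
      classify lluˡ (_ , _ , b , _) = ⊥-elim (upper-free b)
      classify lluʳ (_ , _ , _ , b) = ⊥-elim (upper-free b)
      classify lluuˡ (_ , _ , b , _) = ⊥-elim (upper-free b)
      classify lluuʳ (_ , _ , _ , b) = ⊥-elim (upper-free b)

  upperRegion-at : ∀ {p q R} → UpperRegion p q R → IsTriangle T R → TriangleAt p R × TriangleAt q R
  upperRegion-at three-sided t = (t , here refl) , (t , there (here refl))
  upperRegion-at four-sided  t = (t , here refl) , (t , there (here refl))

  -- A bridging vertex is never the middle corner of three lower vertices, since the long side would
  -- cross its arc. The arcs from `p` and `r` to the upper boundary confine the remaining lower
  -- triangles to the two fans.
  triangles-at-bridging : ∀ {p q r R R′} → Consecutive p q → Consecutive q r →
    UpperRegion p q R → IsTriangle T R → UpperRegion q r R′ → IsTriangle T R′ →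
    ∀ {S} → TriangleAt q S → (S ≡ R ⊎ S ≡ R′) ⊎ LeftFan p q S ⊎ RightFan q r S
  triangles-at-bridging {p} {q} {r} {R} {R′} pq qr u t u′ t′ {S} (s , q∈S) = classify (cornerAt S q∈S) s
    where
    left-region : ∀ {a S} → UpperRegion a q S → IsTriangle T S →
        (S ≡ R ⊎ S ≡ R′) ⊎ LeftFan p q S ⊎ RightFan q r S
    left-region w s with consecutive-uniqueˡ (consecutive-corners w s) pq
    ... | refl = inj₁ (inj₁ (upperTriangle-unique w u s t))
    right-region : ∀ {a S} → UpperRegion q a S → IsTriangle T S →
        (S ≡ R ⊎ S ≡ R′) ⊎ LeftFan p q S ⊎ RightFan q r S
    right-region w s with consecutive-uniqueʳ (consecutive-corners w s) qr
    ... | refl = inj₁ (inj₂ (upperTriangle-unique w u′ s t′))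
    classify : ∀ {S} → CornerAt q S → IsTriangle T S → (S ≡ R ⊎ S ≡ R′) ⊎ LeftFan p q S ⊎ RightFan q r S
    classify (lllˡ {a} {b}) s@(q<a , a<b , qa , ab , qb) with b ≤? r
    ... | yes b≤r = inj₂ (inj₂ (rightFan s b≤r))
    ... | no b≰r = ⊥-elim (—-noncrossing (fin q) (fin b) (fin r) ∞
                     (Consecutive.ordered qr) (≰⇒> b≰r) tt qb (Consecutive.right qr))
    classify (lllʳ {a} {b}) s@(a<b , b<q , ab , bq , aq) with p ≤? a
    ... | yes p≤a = inj₂ (inj₁ (leftFan s p≤a))
    ... | no p≰a = ⊥-elim (—-noncrossing (fin a) (fin q) (fin p) ∞
                     (≰⇒> p≰a) (Consecutive.ordered pq) tt aq (Consecutive.left pq))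
    classify (lllᵐ {a} {b}) s@(a<q , q<b , aq , qb , ab) =
      ⊥-elim (—-noncrossing (fin a) (fin b) (fin q) ∞ a<q q<b tt ab (Consecutive.right pq))
    classify lluˡ s = right-region three-sided s
    classify lluʳ s = left-region three-sided s
    classify lluuˡ s = right-region four-sided s
    classify lluuʳ s = left-region four-sided s

  -- Solutions of the recurrence

  -- The rules below are linear and homogeneous in `g`, hence hold for every solution; the starting
  -- vertex comes in later, through the initial values.
  module Solution (g : ℤ → ℤ)
    (recurrence : ∀ p → ∃[ c ] NumberOfTrianglesAt T (lower p) c × g (p + + 1) + g (p - + 1) ≡ + c * g p) where

    -- Going around `p` from its neighbour `p + 1` to `q` crosses each triangle of the fan once, and
    -- each crossing subtracts `g p`.
    RightCount LeftCount : ℤ → ℤ → Set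
    RightCount p q = Σ (Enumeration (RightFan p q)) λ E → g q ≡ g (p + + 1) - + size E * g p
    LeftCount  p q = Σ (Enumeration (LeftFan p q))  λ E → g p ≡ g (q - + 1) - + size E * g q

    -- The triangles at q are those of E and those in the fans under pq and qr.
    balance : ∀ {p q r P} (E : Enumeration P) → LeftCount p q → RightCount q r →
              (∀ {R} → P R → TriangleAt q R × ¬ (LeftFan p q R ⊎ RightFan q r R)) →
              (∀ {R} → TriangleAt q R → P R ⊎ LeftFan p q R ⊎ RightFan q r R) →
              g p + g r ≡ + size E * g q
    balance {p} {q} {r} {P} E (L , gp) (F , gr) P⇒ ⇒P with recurrence q
    ... | c , number , rec = begin
      g p + g r
        ≡⟨ cong₂ _+_ gp gr ⟩
      (g (q - + 1) - + size L * g q) + (g (q + + 1) - + size F * g q)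
        ≡⟨ rearrange (g (q - + 1)) (+ size L) (g q) (g (q + + 1)) (+ size F) ⟩
      (g (q + + 1) + g (q - + 1)) - (+ size L + + size F) * g q
        ≡⟨ cong (_- (+ size L + + size F) * g q) rec ⟩
      + c * g q - (+ size L + + size F) * g q
        ≡⟨ cong (λ z → z * g q - (+ size L + + size F) * g q) c≡ ⟩
      (+ size E + (+ size L + + size F)) * g q - (+ size L + + size F) * g q
        ≡⟨ cancel (+ size E) (+ size L + + size F) (g q) ⟩
      + size E * g q ∎
      where
      open ≡-Reasoning
      rearrange : ∀ a l x b r → (a - l * x) + (b - r * x) ≡ (b + a) - (l + r) * x
      rearrange = solve-∀
      cancel : ∀ e s x → (e + s) * x - s * x ≡ e * x
      cancel = solve-∀
      fans : Enumeration (λ R → LeftFan p q R ⊎ RightFan q r R)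
      fans = union fans-disjoint L F
      all : Enumeration (λ R → P R ⊎ LeftFan p q R ⊎ RightFan q r R)
      all = union (λ e → proj₂ (P⇒ e)) E fans
      at : ∀ {R} → P R ⊎ LeftFan p q R ⊎ RightFan q r R → TriangleAt q R
      at (inj₁ e) = proj₁ (P⇒ e)
      at (inj₂ (inj₁ l)) = leftFan-at l
      at (inj₂ (inj₂ f)) = rightFan-at f
      c≡ : + c ≡ + size E + (+ size L + + size F)
      c≡ = cong +_ (begin
        c                                 ≡⟨ numberOfTriangles number all at ⇒P ⟩
        size all                          ≡⟨ size-union (λ e → proj₂ (P⇒ e)) E fans ⟩
        size E ℕ.+ size fans              ≡⟨ cong (size E ℕ.+_) (size-union fans-disjoint L F) ⟩
        size E ℕ.+ (size L ℕ.+ size F)    ∎)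

    -- Mutual induction with `apex-sum`: the counts of the two halves give the sum rule at the apex,
    -- and the sum rule extends the counts by the one triangle glued on.
    fans : ∀ {p q} → Polygon p q → RightCount p q × LeftCount p q
    apex-sum : ∀ {p q r} → IsTriangle T (lll p q r) → LeftCount p q → RightCount q r → g q ≡ g p + g r

    apex-sum {p} {q} {r} t@(p<q , q<r , _) L F =
      trans (sym (*-identityˡ (g q))) (sym (balance (singleton (lll p q r)) L F
        (λ { refl → (t , there (here refl)) , λ { (inj₁ (leftFan _ _)) → <-irrefl refl q<r
                                                ; (inj₂ (rightFan _ _)) → <-irrefl refl p<q } })
        (triangles-at-apex t)))

    fans (edge {p}) = (none edge-rightFan , sym (zero-times (g (p + + 1)) (g p))) ,
                      (none edge-leftFan , trans (cong g (lemma p))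
                          (sym (zero-times (g (p + + 1 - + 1)) (g (p + + 1)))))
      where
      zero-times : ∀ x y → x - + 0 * y ≡ x
      zero-times = solve-∀
      lemma : ∀ p → p ≡ p + + 1 - + 1
      lemma = solve-∀
    fans (glue {p} {q} {r} t P Q) with fans P | fans Q
    ... | (F , gq) , L | F′ , (L′ , gq′) =
      (rightFan-glue t F , trans (solve-r (g p) (g q) (g r) q=p+r)
          (trans (cong (_- g p) gq) (one-more (g (p + + 1)) (+ size F) (g p)))) ,
      (leftFan-glue t L′ , trans (solve-p (g p) (g q) (g r) q=p+r)
          (trans (cong (_- g r) gq′) (one-more (g (r - + 1)) (+ size L′) (g r))))
      where
      q=p+r : g q ≡ g p + g r
      q=p+r = apex-sum t L F′
      expand-r : ∀ p r → r ≡ p + r - p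
      expand-r = solve-∀
      expand-p : ∀ p r → p ≡ p + r - r
      expand-p = solve-∀
      solve-r : ∀ p q r → q ≡ p + r → r ≡ q - p
      solve-r p q r refl = expand-r p r
      solve-p : ∀ p q r → q ≡ p + r → p ≡ q - r
      solve-p p q r refl = expand-p p r
      one-more : ∀ a s x → a - s * x - x ≡ a - (+ 1 + s) * x
      one-more = solve-∀

    triangle-sum : ∀ {p q r} → IsTriangle T (lll p q r) → g q ≡ g p + g r
    triangle-sum t@(p<q , q<r , pq , qr , _) =
      apex-sum t (proj₂ (fans (polygon p<q pq))) (proj₁ (fans (polygon q<r qr)))

    -- A bridging vertex lies in two triangles touching the upper boundary.
    gap : ∀ {p q r} → Consecutive p q → Consecutive q r → g q - g p ≡ g r - g q
    gap {p} {q} {r} pq qr with upperTriangle pq | upperTriangle qr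
    ... | R , u , t | R′ , u′ , t′ =
      solve-gap (g p) (g q) (g r) (balance E (proj₂ (fans (consecutive-polygon pq)))
          (proj₁ (fans (consecutive-polygon qr)))
        (λ { (inj₁ refl) → proj₂ (upperRegion-at u t) , not-lower u
           ; (inj₂ refl) → proj₁ (upperRegion-at u′ t′) , not-lower u′ })
        (triangles-at-bridging pq qr u t u′ t′))
      where
      not-lower : ∀ {a b S} → UpperRegion a b S → ¬ (LeftFan p q S ⊎ RightFan q r S)
      not-lower three-sided (inj₁ ())
      not-lower three-sided (inj₂ ())
      not-lower four-sided (inj₁ ())
      not-lower four-sided (inj₂ ())
      distinct : ∀ {R R′} → UpperRegion p q R → UpperRegion q r R′ → ¬ R ≡ R′
      distinct three-sided three-sided refl = <-irrefl refl (Consecutive.ordered pq)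
      distinct four-sided four-sided refl = <-irrefl refl (Consecutive.ordered pq)
      E : Enumeration (λ S → S ≡ R ⊎ S ≡ R′)
      E = union {_≡ R} {_≡ R′} (λ S≡R S≡R′ → distinct u u′ (trans (sym S≡R) S≡R′)) (singleton R) (singleton R′)
      expand : ∀ p q r → r - q ≡ (p + r) - p - q
      expand = solve-∀
      collect : ∀ p q → + 2 * q - p - q ≡ q - p
      collect = solve-∀
      solve-gap : ∀ p q r → p + r ≡ + 2 * q → q - p ≡ r - q
      solve-gap p q r eq = sym (trans (expand p q r) (trans (cong (λ z → z - p - q) eq) (collect p q)))

    gap-constant-≤ : ∀ d {a a′ b b′} → a ≤ b → b ≤ a + + d → Consecutive a a′ → Consecutive b b′ →
                     g a′ - g a ≡ g b′ - g b
    gap-constant-≤ d {a} {a′} {b} {b′} a≤b b≤ ca cb with <-cmp a b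
    ... | tri≈ _ refl _ with consecutive-uniqueʳ ca cb
    ... | refl = refl
    gap-constant-≤ d a≤b b≤ ca cb | tri> _ _ b<a = ⊥-elim (<⇒≱ b<a a≤b)
    gap-constant-≤ ℕ.zero {a} {b = b} a≤b b≤ ca cb | tri< a<b _ _ =
      ⊥-elim (<⇒≱ a<b (subst (b ≤_) (+-identityʳ a) b≤))
    gap-constant-≤ (ℕ.suc d) {a} {a′} {b} a≤b b≤ ca cb | tri< a<b _ _ with consecutive-next
        (Consecutive.right ca)
    ... | a″ , ca′ = trans (gap ca ca′) (gap-constant-≤ d
      (≮⇒≥ λ b<a′ → Consecutive.between ca a<b b<a′ (Consecutive.left cb))
      (≤-trans (subst (b ≤_) (i+suc-d a d) b≤) (+-monoˡ-≤ (+ d) (i<j⇒i+1≤j (Consecutive.ordered ca)))) ca′ cb)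

    gap-constant : ∀ {a a′ b b′} → Consecutive a a′ → Consecutive b b′ → g a′ - g a ≡ g b′ - g b
    gap-constant {a} {b = b} ca cb with ≤-total a b
    ... | inj₁ a≤b with i≤j⇒j≡i+d a≤b
    ... | d , eq = gap-constant-≤ d a≤b (≤-reflexive eq) ca cb
    gap-constant {a} {b = b} ca cb | inj₂ b≤a with i≤j⇒j≡i+d b≤a
    ... | d , eq = sym (gap-constant-≤ d b≤a (≤-reflexive eq) cb ca)

-- Correctness and completeness of the labelling

module Labelling (n : ℕ) .{{nz : NonZero n}} (T : Rel Vertex 0ℓ) (periodic : IsPeriodicTriangulation n T)
  (g : ℤ → ℤ)
  (recurrence : ∀ p → ∃[ c ] NumberOfTrianglesAt T (lower p) c × g (p + + 1) + g (p - + 1) ≡ + c * g p)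
  (v : ℤ) (g-v : g v ≡ + 0) (g-v+1 : g (v + + 1) ≡ + 1) where

  open Triangulated n T periodic
  open Solution g recurrence
  open IsTriangulation (IsPeriodicTriangulation.isTriangulation periodic)
  open IsNonCrossing isNonCrossing

  g-v-1 : g (v - + 1) ≡ - (+ 1)
  g-v-1 with recurrence v
  ... | c , _ , eq = begin
    g (v - + 1)                               ≡⟨ lemma (g (v + + 1)) (g (v - + 1)) ⟩
    (g (v + + 1) + g (v - + 1)) - g (v + + 1)
        ≡⟨ cong₂ _-_ (trans eq (trans (cong (_*_ (+ c)) g-v) (*-zeroʳ (+ c)))) g-v+1 ⟩
    - (+ 1)                                   ∎
    where
    open ≡-Reasoning
    lemma : ∀ x y → y ≡ (x + y) - x
    lemma = solve-∀

  -- A reference pair for the value at `∞`; by `gap-constant` any other pair gives the same value.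
  bridging₀ : ∃[ b ] ∃[ b′ ] Consecutive b b′
  bridging₀ = let b , t = bridge (+ 0) in b , consecutive-next (arc⇒bridging t)

  value : Point → ℤ
  value (fin p) = g p
  value ∞       = g (proj₁ (proj₂ bridging₀)) - g (proj₁ bridging₀)

  value-∞ : ∀ {b b′} → Consecutive b b′ → g b′ - g b ≡ value ∞
  value-∞ con = gap-constant con (proj₂ (proj₂ bridging₀))

  -- `Corners` after the collapse, with the corner to be labelled last, so that all kinds of regions
  -- share one argument.
  data Arrangement (a b c : Point) : Point → Point → Point → Set where
    new-left   : Arrangement a b c b c a
    new-middle : Arrangement a b c a c b
    new-right  : Arrangement a b c a b c

  record Triangle (a b c : Point) : Set where
    field
      a⊏b : a ⊏ b
      b⊏c : b ⊏ c
      ab  : a — b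
      bc  : b — c
      ac  : a — c
      sum-rule : value b ≡ value a + value c

  leftCorner middleCorner rightCorner : Region → Point
  leftCorner (lll p q r)    = fin p
  leftCorner (llu p q k)    = fin p
  leftCorner (lluu p q k)   = fin p
  middleCorner (lll p q r)  = fin q
  middleCorner (llu p q k)  = fin q
  middleCorner (lluu p q k) = fin q
  rightCorner (lll p q r)   = fin r
  rightCorner (llu p q k)   = ∞
  rightCorner (lluu p q k)  = ∞

  arrangement : ∀ {R w₁ w₂ w₃} → Corners R w₁ w₂ w₃ →
                Arrangement (leftCorner R) (middleCorner R) (rightCorner R) (π w₁) (π w₂) (π w₃)
  arrangement lll₁  = new-left
  arrangement lll₂  = new-middle
  arrangement lll₃  = new-right
  arrangement llu₁  = new-left
  arrangement llu₂  = new-middle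
  arrangement llu₃  = new-right
  arrangement lluu₁ = new-left
  arrangement lluu₂ = new-middle
  arrangement lluu₃ = new-right

  upper-triangle : ∀ {p q R} → UpperRegion p q R → IsTriangle T R → Triangle (fin p) (fin q) ∞
  upper-triangle {p} {q} u t = record
    { a⊏b = ordered ; b⊏c = tt ; ab = consecutive-side con ; bc = right ; ac = left
    ; sum-rule = trans (lemma (g p) (g q)) (cong (_+_ (g p)) (value-∞ con)) }
    where
    con = consecutive-corners u t
    open Consecutive con
    lemma : ∀ x y → y ≡ x + (y - x)
    lemma = solve-∀

  triangle : ∀ R → IsTriangle T R → Triangle (leftCorner R) (middleCorner R) (rightCorner R)
  triangle (lll p q r) t@(p<q , q<r , pq , qr , pr) = record
    { a⊏b = p<q ; b⊏c = q<r ; ab = pq ; bc = qr ; ac = pr ; sum-rule = triangle-sum t }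
  triangle (llu p q k) = upper-triangle three-sided
  triangle (lluu p q k) = upper-triangle four-sided

  module _ {a b c p₁ p₂ p₃ : Point} (t : Triangle a b c) where
    open Triangle t

    new—first : Arrangement a b c p₁ p₂ p₃ → p₃ — p₁
    new—first new-left   = ab
    new—first new-middle = —-sym a b ab
    new—first new-right  = —-sym a c ac

    new—second : Arrangement a b c p₁ p₂ p₃ → p₃ — p₂
    new—second new-left   = ac
    new—second new-middle = bc
    new—second new-right  = —-sym b c bc

    first≢second : Arrangement a b c p₁ p₂ p₃ → p₁ ≢ p₂
    first≢second new-left   refl = ⊏-irrefl b b⊏c
    first≢second new-middle refl = ⊏-irrefl a (⊏-trans a b c a⊏b b⊏c)
    first≢second new-right  refl = ⊏-irrefl a a⊏b

  -- Separation

  Inside Outside : Point → Point → Point → Set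
  Inside  a b x = a ⊏ x × x ⊏ b
  Outside a b x = x ⊏ a ⊎ b ⊏ x

  Separates : Point → Point → Point → Point → Set
  Separates a b x y = (Inside a b x × Outside a b y) ⊎ (Outside a b x × Inside a b y)

  ¬inside-outside : ∀ a b x y → a — b → x — y → Inside a b x → ¬ Outside a b y
  ¬inside-outside a b x y ab xy (ax , xb) (inj₁ ya) = —-noncrossing y x a b ya ax xb (—-sym x y xy) ab
  ¬inside-outside a b x y ab xy (ax , xb) (inj₂ by) = —-noncrossing a b x y ax xb by ab xy

  side-not-separated : ∀ a b x y → a — b → x — y → ¬ Separates a b x y
  side-not-separated a b x y ab xy (inj₁ (i , o)) = ¬inside-outside a b x y ab xy i o
  side-not-separated a b x y ab xy (inj₂ (o , i)) = ¬inside-outside a b y x ab (—-sym x y xy) i o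

  ¬separates-self : ∀ a b x → ¬ Separates a b x x
  ¬separates-self a b x = λ { (inj₁ (i , o)) → both i o ; (inj₂ (o , i)) → both i o }
    where
    both : Inside a b x → ¬ Outside a b x
    both (ax , xb) (inj₁ xa) = ⊏-asym a x ax xa
    both (ax , xb) (inj₂ bx) = ⊏-asym x b xb bx

  locate : ∀ a b y → y ≡ a ⊎ y ≡ b ⊎ Inside a b y ⊎ Outside a b y
  locate a b y with ⊏-cmp y a | ⊏-cmp y b
  ... | tri< ya _ _ | _ = inj₂ (inj₂ (inj₂ (inj₁ ya)))
  ... | tri≈ _ eq _ | _ = inj₁ eq
  ... | tri> _ _ ay | tri< yb _ _ = inj₂ (inj₂ (inj₁ (ay , yb)))
  ... | tri> _ _ ay | tri≈ _ eq _ = inj₂ (inj₁ eq)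
  ... | tri> _ _ ay | tri> _ _ by = inj₂ (inj₂ (inj₂ (inj₂ by)))

  -- A side cannot cross `a b`, so its far end stays on the same side of that chord or is one of its
  -- ends. This carries separation from a newly labelled corner to the two corners that its label
  -- came from.
  separates-along : ∀ a b x y z → a — b → y — z → Separates a b x y →
                    z ≡ a ⊎ z ≡ b ⊎ Separates a b x z
  separates-along a b x y z ab yz sep with locate a b z | sep
  ... | inj₁ eq | _ = inj₁ eq
  ... | inj₂ (inj₁ eq) | _ = inj₂ (inj₁ eq)
  ... | inj₂ (inj₂ (inj₁ iz)) | inj₁ (ix , oy) = ⊥-elim (¬inside-outside a b z y ab (—-sym y z yz) iz oy)
  ... | inj₂ (inj₂ (inj₁ iz)) | inj₂ (ox , iy) = inj₂ (inj₂ (inj₂ (ox , iz)))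
  ... | inj₂ (inj₂ (inj₂ oz)) | inj₁ (ix , oy) = inj₂ (inj₂ (inj₁ (ix , oz)))
  ... | inj₂ (inj₂ (inj₂ oz)) | inj₂ (ox , iy) = ⊥-elim (¬inside-outside a b y z ab yz iy oz)

  -- The point `∞` lies to the right of every lower vertex and therefore keeps the positive sign.
  label : Point → ℤ
  label a with ⊏-cmp (fin v) a
  ... | tri< _ _ _ = value a
  ... | tri≈ _ _ _ = value a
  ... | tri> _ _ _ = - value a

  label-right : ∀ a → fin v ⊏ a → label a ≡ value a
  label-right a va with ⊏-cmp (fin v) a
  ... | tri< _ _ _ = refl
  ... | tri≈ _ _ _ = refl
  ... | tri> ¬va _ _ = ⊥-elim (¬va va)

  label-left : ∀ a → a ⊏ fin v → label a ≡ - value a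
  label-left a av with ⊏-cmp (fin v) a
  ... | tri< _ _ ¬av = ⊥-elim (¬av av)
  ... | tri≈ _ _ ¬av = ⊥-elim (¬av av)
  ... | tri> _ _ _ = refl

  label-self : label (fin v) ≡ + 0
  label-self with ⊏-cmp (fin v) (fin v)
  ... | tri< _ _ _ = g-v
  ... | tri≈ _ _ _ = g-v
  ... | tri> _ _ _ = cong -_ g-v

  -- Around `v` the fan subtracts multiples of `g v = 0`, so the value stays that of the neighbour
  -- of `v`: 1 on the right, - 1 on the left. If `v` is bridging, the gap to the next bridging
  -- vertex `b` is `g b`, and `b` is itself joined to `v`.
  label-joined : ∀ a → fin v — a → label a ≡ + 1
  label-joined (fin p) s with ⊏-cmp (fin v) (fin p)
  ... | tri< v<p _ _ with proj₁ (fans (polygon v<p s))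
  ... | E , eq = trans eq (trans (cong₂ (λ x y → x - + size E * y) g-v+1 g-v) (lemma (+ size E)))
    where
    lemma : ∀ s → + 1 - s * + 0 ≡ + 1
    lemma = solve-∀
  label-joined (fin p) s | tri> _ _ p<v with proj₂ (fans (polygon p<v (—-sym (fin v) (fin p) s)))
  ... | E , eq = cong -_ (trans eq (trans (cong₂ (λ x y → x - + size E * y) g-v-1 g-v) (lemma (+ size E))))
    where
    lemma : ∀ s → - (+ 1) - s * + 0 ≡ - (+ 1)
    lemma = solve-∀
  label-joined (fin p) (inj₁ (inj₁ eq)) | tri≈ _ refl _ = ⊥-elim (<-irrefl eq (i<i+1 v))
  label-joined (fin p) (inj₁ (inj₂ eq)) | tri≈ _ refl _ = ⊥-elim (<-irrefl eq (i<i+1 v))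
  label-joined (fin p) (inj₂ t) | tri≈ _ refl _ = ⊥-elim (proj₁ (IsArc.A2 (arcs t)) refl)
  label-joined ∞ bv with consecutive-next bv
  ... | b , con = begin
    label ∞    ≡⟨ label-right ∞ tt ⟩
    value ∞    ≡⟨ sym (value-∞ con) ⟩
    g b - g v  ≡⟨ cong₂ _-_ gb≡1 g-v ⟩
    + 1        ∎
    where
    open ≡-Reasoning
    gb≡1 : g b ≡ + 1
    gb≡1 = trans (sym (label-right (fin b) (Consecutive.ordered con)))
        (label-joined (fin b) (consecutive-side con))

  -- Invariants of the stages of the procedure

  At : PartialLabelling → Point → Set
  At L a = ∃[ w ] π w ≡ a × Labelled L w

  -- closed: a vertex separated from v by a side is never labelled before the
  -- ends of that side, whence a triangle always passes labels away from v.
  record Sound (L : PartialLabelling) : Set where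
    field
      correct   : ∀ {w y} → L w y → + y ≡ label (π w)
      closed    : ∀ a b x → a ⊏ b → a — b → Separates a b (fin v) x → At L x → At L a × At L b
      initial   : ∀ {u y} → Initial T (lower v) u y → Labelled L u
      saturated : ∀ {u w y} → L u y → π u ≡ π w → L w y

    initial-at : ∀ a → fin v — a → At L a
    initial-at (fin p) s = lower p , refl , initial (joined s refl)
    initial-at ∞ t = upper (superscript n (lower v)) , refl , initial (joined (inj₂ (symmetric t)) tt)

    at⇒labelled : ∀ w → At L (π w) → Labelled L w
    at⇒labelled w (u , eq , y , l) = y , saturated l eq

  -- `closed` holds vacuously at the start: no side separates `v` from itself or from a vertex
  -- joined to it.
  sound-initial : Sound (Initial T (lower v))
  sound-initial = record { correct = correct ; closed = closed ; initial = λ i → _ , i ; saturated = saturated }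
    where
    correct : ∀ {w y} → Initial T (lower v) w y → + y ≡ label (π w)
    correct self = sym label-self
    correct {u} (joined {w = w} s u≈w) =
      sym (trans (cong label (≈⇒π≡ u w u≈w)) (label-joined (π w) (side⇒— {w = w} s)))

    closed : ∀ a b x → a ⊏ b → a — b → Separates a b (fin v) x →
             At (Initial T (lower v)) x → At (Initial T (lower v)) a × At (Initial T (lower v)) b
    closed a b _ _ _ sep (_ , refl , _ , self) = ⊥-elim (¬separates-self a b (fin v) sep)
    closed a b _ _ ab sep (u , refl , _ , joined {w = w} s u≈w) =
      ⊥-elim (side-not-separated a b (fin v) (π w) ab (side⇒— {w = w} s)
          (subst (Separates a b (fin v)) (≈⇒π≡ u w u≈w) sep))

    saturated : ∀ {u w y} → Initial T (lower v) u y → π u ≡ π w → Initial T (lower v) w y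
    saturated {w = lower _} self eq = subst (λ x → Initial T (lower v) (lower x) 0) (fin-injective eq) self
    saturated {u} {w} (joined {w = w′} s u≈w′) eq = joined s (π≡⇒≈ w w′ (trans (sym eq) (≈⇒π≡ u w′ u≈w′)))

  module _ {L : PartialLabelling} (sound : Sound L) where
    open Sound sound

    PropagatesIn : Point → Point → Point → Set
    PropagatesIn a b c = ∀ {p₁ p₂ p₃} → Arrangement a b c p₁ p₂ p₃ → At L p₁ → At L p₂ → ¬ At L p₃ →
                         label p₃ ≡ label p₁ + label p₂

    -- The side of the triangle facing v separates v from the third corner, so
    -- only that corner can be the unlabelled one.
    label-sum : ∀ {a b c} → Triangle a b c → PropagatesIn a b c
    label-sum {a} {b} {c} t = go (⊏-cmp (fin v) a) (⊏-cmp (fin v) b) (⊏-cmp (fin v) c)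
      where
      open Triangle t
      a⊏c : a ⊏ c
      a⊏c = ⊏-trans a b c a⊏b b⊏c
      all-labelled : At L a → At L b → At L c → PropagatesIn a b c
      all-labelled la lb lc new-left   _ _ ¬l = ⊥-elim (¬l la)
      all-labelled la lb lc new-middle _ _ ¬l = ⊥-elim (¬l lb)
      all-labelled la lb lc new-right  _ _ ¬l = ⊥-elim (¬l lc)
      v-at : At L (fin v)
      v-at = lower v , refl , initial self
      neg-sum : ∀ x y z → y ≡ x + z → - y ≡ - x + - z
      neg-sum x y z refl = neg-distrib-+ x z
      right-sum : ∀ x y z → y ≡ x + z → z ≡ - x + y
      right-sum x y z refl = lemma x z
        where
        lemma : ∀ x z → z ≡ - x + (x + z)
        lemma = solve-∀
      left-sum : ∀ x y z → y ≡ x + z → - x ≡ - y + z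
      left-sum x y z refl = lemma x z
        where
        lemma : ∀ x z → - x ≡ - (x + z) + z
        lemma = solve-∀
      go : Tri (fin v ⊏ a) (fin v ≡ a) (a ⊏ fin v) → Tri (fin v ⊏ b) (fin v ≡ b) (b ⊏ fin v) →
           Tri (fin v ⊏ c) (fin v ≡ c) (c ⊏ fin v) →
           PropagatesIn a b c
      -- If `v` is a corner, the other two corners are joined to it and all three are labelled from
      -- the start.
      go (tri≈ _ refl _) _ _ = all-labelled v-at (initial-at b ab) (initial-at c ac)
      go _ (tri≈ _ refl _) _ = all-labelled (initial-at a (—-sym a b ab)) v-at (initial-at c bc)
      go _ _ (tri≈ _ refl _) = all-labelled (initial-at a (—-sym a c ac)) (initial-at b (—-sym b c bc)) v-at
      -- In the four remaining positions the side facing `v` is `a c`, `a b`, `b c`, `a c` in turn.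
      -- With the signs inserted, the one rule for values becomes the sum formula for the opposite
      -- corner.
      go (tri< va _ _) _ _ = beyond-middle
        where
        ends : At L b → At L a × At L c
        ends = closed a c b a⊏c ac (inj₂ (inj₁ va , a⊏b , b⊏c))
        beyond-middle : PropagatesIn a b c
        beyond-middle new-left  lb _ ¬la = ⊥-elim (¬la (proj₁ (ends lb)))
        beyond-middle new-right _ lb ¬lc = ⊥-elim (¬lc (proj₂ (ends lb)))
        beyond-middle new-middle _ _ _ = trans (label-right b (⊏-trans (fin v) a b va a⊏b)) (trans sum-rule
          (sym (cong₂ _+_ (label-right a va) (label-right c (⊏-trans (fin v) a c va a⊏c)))))
      go (tri> _ _ av) (tri< vb _ _) _ = beyond-right
        where
        ends : At L c → At L a × At L b
        ends = closed a b c a⊏b ab (inj₁ ((av , vb) , inj₂ b⊏c))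
        beyond-right : PropagatesIn a b c
        beyond-right new-left   _ lc ¬la = ⊥-elim (¬la (proj₁ (ends lc)))
        beyond-right new-middle _ lc ¬lb = ⊥-elim (¬lb (proj₂ (ends lc)))
        beyond-right new-right  _ _ _ = trans (label-right c (⊏-trans (fin v) b c vb b⊏c))
            (trans (right-sum (value a) _ _ sum-rule)
          (sym (cong₂ _+_ (label-left a av) (label-right b vb))))
      go _ (tri> _ _ bv) (tri< vc _ _) = beyond-left
        where
        ends : At L a → At L b × At L c
        ends = closed b c a b⊏c bc (inj₁ ((bv , vc) , inj₁ a⊏b))
        beyond-left : PropagatesIn a b c
        beyond-left new-middle la _ ¬lb = ⊥-elim (¬lb (proj₁ (ends la)))
        beyond-left new-right  la _ ¬lc = ⊥-elim (¬lc (proj₂ (ends la)))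
        beyond-left new-left   _ _ _ = trans (label-left a (⊏-trans a b (fin v) a⊏b bv))
            (trans (left-sum (value a) _ _ sum-rule)
          (sym (cong₂ _+_ (label-left b bv) (label-right c vc))))
      go _ _ (tri> _ _ cv) = beyond-middle
        where
        ends : At L b → At L a × At L c
        ends = closed a c b a⊏c ac (inj₂ (inj₂ cv , a⊏b , b⊏c))
        beyond-middle : PropagatesIn a b c
        beyond-middle new-left  lb _ ¬la = ⊥-elim (¬la (proj₁ (ends lb)))
        beyond-middle new-right _ lb ¬lc = ⊥-elim (¬lc (proj₂ (ends lb)))
        beyond-middle new-middle _ _ _ = trans (label-left b (⊏-trans b c (fin v) b⊏c cv))
            (trans (neg-sum (value a) _ _ sum-rule)
          (sym (cong₂ _+_ (label-left a (⊏-trans a c (fin v) a⊏c cv)) (label-left c cv))))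

    sound-step : ∀ {R w x} → Applicable T L R w x → Sound (L [ w ↦ x ])
    sound-step {R} {w} (sum {w₁} {w₂} {x₁ = x₁} {x₂} isT corners l₁ l₂ ¬l₃) = record
      { correct = correct′ ; closed = closed′ ; saturated = saturated′
      ; initial = λ i → let y , l = initial i in y , old l }
      where
      L′ = L [ w ↦ x₁ ℕ.+ x₂ ]
      t : Triangle (leftCorner R) (middleCorner R) (rightCorner R)
      t = triangle R isT
      at₁ : At L (π w₁)
      at₁ = w₁ , refl , x₁ , l₁
      at₂ : At L (π w₂)
      at₂ = w₂ , refl , x₂ , l₂

      correct′ : ∀ {u y} → L′ u y → + y ≡ label (π u)
      correct′ (old l) = correct l
      correct′ {u} (new u≈w) = begin
        + (x₁ ℕ.+ x₂)                 ≡⟨ pos-+ x₁ x₂ ⟩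
        + x₁ + + x₂                   ≡⟨ cong₂ _+_ (correct l₁) (correct l₂) ⟩
        label (π w₁) + label (π w₂)   ≡⟨ sym (label-sum t (arrangement corners) at₁ at₂ (¬l₃ ∘ at⇒labelled w)) ⟩
        label (π w)                   ≡⟨ cong label (sym (≈⇒π≡ u w u≈w)) ⟩
        label (π u)                   ∎
        where open ≡-Reasoning

      keep : ∀ {a} → At L a → At L′ a
      keep (u , eq , y , l) = u , eq , y , old l

      closed′ : ∀ a b x → a ⊏ b → a — b → Separates a b (fin v) x → At L′ x → At L′ a × At L′ b
      closed′ a b _ a⊏b ab sep (u , refl , y , old l) =
        let la , lb = closed a b (π u) a⊏b ab sep (u , refl , y , l) in keep la , keep lb
      -- Each of `w₁`, `w₂` is joined to `w`, so it lies beyond the chord as well or is one of its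
      -- ends. In the first case the old invariant applies; otherwise, being distinct, they are the
      -- two ends.
      closed′ a b _ a⊏b ab sep (u , refl , y , new u≈w) =
        let la , lb = ends (along at₁ (new—first t (arrangement corners)))
                           (along at₂ (new—second t (arrangement corners)))
        in keep la , keep lb
        where
        sep-w : Separates a b (fin v) (π w)
        sep-w = subst (Separates a b (fin v)) (≈⇒π≡ u w u≈w) sep
        along : ∀ {z} → At L z → π w — z → z ≡ a ⊎ z ≡ b ⊎ (At L a × At L b)
        along {z} lz wz = Sum.map₂ (Sum.map₂ (λ s → closed a b z a⊏b ab s lz))
            (separates-along a b (fin v) (π w) z ab wz sep-w)
        ends : π w₁ ≡ a ⊎ π w₁ ≡ b ⊎ (At L a × At L b) → π w₂ ≡ a ⊎ π w₂ ≡ b ⊎ (At L a × At L b) →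
            At L a × At L b
        ends (inj₂ (inj₂ done)) _ = done
        ends _ (inj₂ (inj₂ done)) = done
        ends (inj₁ p) (inj₁ q) = ⊥-elim (first≢second t (arrangement corners) (trans p (sym q)))
        ends (inj₂ (inj₁ p)) (inj₂ (inj₁ q)) = ⊥-elim (first≢second t (arrangement corners) (trans p (sym q)))
        ends (inj₁ p) (inj₂ (inj₁ q)) = subst (At L) p at₁ , subst (At L) q at₂
        ends (inj₂ (inj₁ p)) (inj₁ q) = subst (At L) q at₂ , subst (At L) p at₁

      saturated′ : ∀ {u u′ y} → L′ u y → π u ≡ π u′ → L′ u′ y
      saturated′ (old l) eq = old (saturated l eq)
      saturated′ {u} {u′} (new u≈w) eq = new (π≡⇒≈ u′ w (trans (sym eq) (≈⇒π≡ u w u≈w)))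

  reached-sound : ∀ {φ L} → Reached T (lower v) φ L → Sound L
  reached-sound start = sound-initial
  reached-sound (lowerStep r _ app) = sound-step (reached-sound r) app
  reached-sound (switch r _) = reached-sound r
  reached-sound (step r app) = sound-step (reached-sound r) app

  -- Running the procedure

  record Between (L : PartialLabelling) (p q : ℤ) : Set where
    field
      at : ∀ {x} → p ≤ x → x ≤ q → Labelled L (lower x)

  open Between

  Extension : Phase → PartialLabelling → (PartialLabelling → Set) → Set₁
  Extension φ L P = Σ PartialLabelling λ L′ →
    Reached T (lower v) φ L′ × (∀ {w} → Labelled L w → Labelled L′ w) × P L′

  ≈-dec : ∀ u w → Dec (u ≈ w)
  ≈-dec (upper _) (upper _) = yes tt
  ≈-dec (upper _) (lower _) = no id
  ≈-dec (lower _) (upper _) = no id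
  ≈-dec (lower p) (lower q) = p ≟ q

  -- A step may only label an unlabelled vertex, so a run has to decide this. It can at reached
  -- stages: `T` decides the initial labels, and each step adds the class of one vertex.
  labelled? : ∀ {φ L} → Reached T (lower v) φ L → ∀ w → Dec (Labelled L w)
  labelled? start (lower p) with p ≟ v | side? v p
  ... | yes refl | _ = yes (0 , self)
  ... | no _ | yes s = yes (1 , joined s refl)
  ... | no p≢v | no ¬s = no λ { (_ , self) → p≢v refl ; (_ , joined {w = lower _} s refl) → ¬s s }
  labelled? start (upper k) with bridging? v
  ... | yes bv = yes (1 , joined (inj₂ (symmetric bv)) tt)
  ... | no ¬bv = no λ { (_ , joined {w = upper l} s _) → ¬bv (side⇒— {w = upper l} s) }
  labelled? (lowerStep {w = w} r _ _) u with labelled? r u | ≈-dec u w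
  ... | yes (y , l) | _ = yes (y , old l)
  ... | no _ | yes u≈w = yes (_ , new u≈w)
  ... | no ¬l | no u≉w = no λ { (y , old l) → ¬l (y , l) ; (_ , new u≈w) → u≉w u≈w }
  labelled? (switch r _) u = labelled? r u
  labelled? (step {w = w} r _) u with labelled? r u | ≈-dec u w
  ... | yes (y , l) | _ = yes (y , old l)
  ... | no _ | yes u≈w = yes (_ , new u≈w)
  ... | no ¬l | no u≉w = no λ { (y , old l) → ¬l (y , l) ; (_ , new u≈w) → u≉w u≈w }

  Usable : Phase → Region → Set
  Usable lowerTriangles R = IsLowerRegion R
  Usable allTriangles   R = ⊤

  lower-usable : ∀ φ {p q r} → Usable φ (lll p q r)
  lower-usable lowerTriangles = isLower
  lower-usable allTriangles   = tt

  ≈-refl : ∀ w → w ≈ w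
  ≈-refl (upper _) = tt
  ≈-refl (lower _) = refl

  extend : ∀ {φ L R w₁ w₂ w₃} → Reached T (lower v) φ L → Usable φ R → IsTriangle T R → Corners R w₁ w₂ w₃ →
           Labelled L w₁ → Labelled L w₂ → Extension φ L λ L′ → Labelled L′ w₃
  extend {φ} {L} {R} {w₁} {w₂} {w₃} r usable t corners (y₁ , l₁) (y₂ , l₂) with labelled? r w₃
  ... | yes l₃ = L , r , id , l₃
  ... | no ¬l₃ = L [ w₃ ↦ y₁ ℕ.+ y₂ ] , reach φ r usable , (λ (y , l) → y , old l) , y₁ ℕ.+ y₂ , new (≈-refl w₃)
    where
    app : Applicable T L R w₃ (y₁ ℕ.+ y₂)
    app = sum t corners l₁ l₂ ¬l₃
    reach : ∀ φ → Reached T (lower v) φ L → Usable φ R → Reached T (lower v) φ (L [ w₃ ↦ y₁ ℕ.+ y₂ ])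
    reach lowerTriangles r isL = lowerStep r isL app
    reach allTriangles   r _   = step r app

  between-edge : ∀ {L p} → Labelled L (lower p) → Labelled L (lower (p + + 1)) → Between L p (p + + 1)
  at (between-edge {L} {p} lp lq) {x} p≤x x≤ with <-cmp x (p + + 1)
  ... | tri< x<q _ _ = subst (Labelled L ∘ lower) (≤-antisym p≤x (i<j+1⇒i≤j x<q)) lp
  ... | tri≈ _ refl _ = lq
  ... | tri> _ _ q<x = ⊥-elim (<⇒≱ q<x x≤)

  between-join : ∀ {L p q r} → Between L p q → Between L q r → Between L p r
  at (between-join {q = q} P Q) {x} p≤x x≤r with ≤-total x q
  ... | inj₁ x≤q = at P p≤x x≤q
  ... | inj₂ q≤x = at Q q≤x x≤r

  between-map : ∀ {L L′ p q} → (∀ {w} → Labelled L w → Labelled L′ w) → Between L p q → Between L′ p q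
  at (between-map keep B) p≤x x≤q = keep (at B p≤x x≤q)

  polygon-< : ∀ {p q} → Polygon p q → p < q
  polygon-< (edge {p}) = i<i+1 p
  polygon-< (glue (p<q , q<r , _) _ _) = <-trans p<q q<r

  -- Labels at both ends of the chord give the apex its label, and then the two halves are filled
  -- from their own chords downwards.
  fill : ∀ {φ L p q} → Polygon p q → Reached T (lower v) φ L → Labelled L (lower p) → Labelled L (lower q) →
         Extension φ L λ L′ → Between L′ p q
  fill edge r lp lq = _ , r , id , between-edge lp lq
  fill {φ} (glue t P Q) r lp lr with extend r (lower-usable φ) t lll₂ lp lr
  ... | L₁ , r₁ , k₁ , l₁ with fill P r₁ (k₁ lp) l₁
  ... | L₂ , r₂ , k₂ , b₂ with fill Q r₂ (k₂ l₁) (k₂ (k₁ lr))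
  ... | L₃ , r₃ , k₃ , b₃ = L₃ , r₃ , k₃ ∘ k₂ ∘ k₁ , between-join (between-map k₃ b₂) b₃

  -- With `v` strictly inside, labels first spread outwards: the half around `v` is filled, its
  -- chord yields the third corner, and the other half is filled downwards. If `v` is the apex, the
  -- ends are labelled initially.
  fill-around : ∀ {p r} → Polygon p r → p < v → v < r →
                Σ PartialLabelling λ L → Reached T (lower v) lowerTriangles L × Between L p r
  fill-around edge p<v v<r = ⊥-elim (<⇒≱ v<r (i<j⇒i+1≤j p<v))
  fill-around (glue {p} {q} {r} t@(_ , _ , pq , qr , _) P Q) p<v v<r with <-cmp v q
  ... | tri≈ _ refl _ with fill P start (1 , joined (—-sym (fin p) (fin v) pq) refl) (0 , self)
  ... | L₁ , r₁ , k₁ , b₁ with fill Q r₁ (k₁ (0 , self)) (k₁ (1 , joined qr refl))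
  ... | L₂ , r₂ , k₂ , b₂ = L₂ , r₂ , between-join (between-map k₂ b₁) b₂
  fill-around (glue t P Q) p<v v<r | tri< v<q _ _ with fill-around P p<v v<q
  ... | L₁ , r₁ , b₁ with extend r₁ isLower t lll₃ (at b₁ ≤-refl (<⇒≤ (<-trans p<v v<q)))
      (at b₁ (<⇒≤ (<-trans p<v v<q)) ≤-refl)
  ... | L₂ , r₂ , k₂ , l₂ with fill Q r₂ (k₂ (at b₁ (<⇒≤ (<-trans p<v v<q)) ≤-refl)) l₂
  ... | L₃ , r₃ , k₃ , b₃ = L₃ , r₃ , between-join (between-map (k₃ ∘ k₂) b₁) b₃
  fill-around (glue t P Q) p<v v<r | tri> _ _ q<v with fill-around Q q<v v<r
  ... | L₁ , r₁ , b₁ with extend r₁ isLower t lll₁ (at b₁ ≤-refl (<⇒≤ (<-trans q<v v<r)))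
      (at b₁ (<⇒≤ (<-trans q<v v<r)) ≤-refl)
  ... | L₂ , r₂ , k₂ , l₂ with fill P r₂ l₂ (k₂ (at b₁ ≤-refl (<⇒≤ (<-trans q<v v<r))))
  ... | L₃ , r₃ , k₃ , b₃ = L₃ , r₃ , between-join b₃ (between-map (k₃ ∘ k₂) b₁)

  -- The lower vertices labelled in the first phase are exactly those from b to b′.
  record Window (b b′ : ℤ) : Set₁ where
    field
      b<v          : b < v
      v<b′         : v < b′
      left         : Bridging b
      right        : Bridging b′
      {labelling}  : PartialLabelling
      reached      : Reached T (lower v) lowerTriangles labelling
      filled       : Between labelling b b′
      upper-vertex : (∀ k → Labelled labelling (upper k)) ⊎ Consecutive b b′

  -- If `v` is bridging, the window covers the two gaps next to it and the upper boundary is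
  -- labelled initially. Otherwise it is the single gap around `v`, and the triangle over this gap
  -- will label the upper boundary.
  window : ∃[ b ] ∃[ b′ ] Window b b′
  window with bridging? v
  ... | no ¬bv with consecutive-around ¬bv
  ... | b , b′ , b<v , v<b′ , con with fill-around (consecutive-polygon con) b<v v<b′
  ... | L , r , filled = b , b′ , record
    { b<v = b<v ; v<b′ = v<b′ ; left = Consecutive.left con ; right = Consecutive.right con
    ; reached = r ; filled = filled ; upper-vertex = inj₂ con }
  window | yes bv with consecutive-previous bv | consecutive-next bv
  ... | b , con | b′ , con′
    with fill (consecutive-polygon con) start
              (1 , joined (—-sym (fin b) (fin v) (consecutive-side con)) refl) (0 , self)
  ... | L₁ , r₁ , k₁ , b₁
    with fill (consecutive-polygon con′) r₁ (k₁ (0 , self)) (k₁ (1 , joined (consecutive-side con′) refl))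
  ... | L₂ , r₂ , k₂ , b₂ = b , b′ , record
    { b<v = Consecutive.ordered con ; v<b′ = Consecutive.ordered con′
    ; left = Consecutive.left con ; right = Consecutive.right con′
    ; reached = r₂ ; filled = between-join (between-map k₂ b₁) b₂
    ; upper-vertex = inj₁ λ k → k₂ (k₁ (1 , joined (inj₂ (symmetric bv)) tt)) }

  -- End of the first phase and the run to the right in the second

  module _ {b b′ : ℤ} (win : Window b b′) where
    open Window win

    In : Vertex → Set
    In (lower x) = b ≤ x × x ≤ b′
    In (upper _) = ⊥

    -- A triangle reaching out of the window would have a side passing under the arc from `b` or
    -- `b′` to the upper boundary, hence crossing it.
    corners-in : ∀ {R w₁ w₂ w₃} → IsLowerRegion R → IsTriangle T R → Corners R w₁ w₂ w₃ → In w₁ → In w₂ → In w₃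
    corners-in {lll p q r} isLower (p<q , q<r , pq , qr , pr) = go
      where
      r≤b′ : p < b′ → r ≤ b′
      r≤b′ p<b′ = ≮⇒≥ λ b′<r → —-noncrossing (fin p) (fin r) (fin b′) ∞ p<b′ b′<r tt pr right
      b≤p : b < r → b ≤ p
      b≤p b<r = ≮⇒≥ λ p<b → —-noncrossing (fin p) (fin r) (fin b) ∞ p<b b<r tt pr left
      go : ∀ {w₁ w₂ w₃} → Corners (lll p q r) w₁ w₂ w₃ → In w₁ → In w₂ → In w₃
      go lll₁ (b≤q , q≤b′) _ = b≤p (≤-<-trans b≤q q<r) , ≤-trans (<⇒≤ p<q) q≤b′
      go lll₂ (b≤p , _) (_ , r≤b′) = ≤-trans b≤p (<⇒≤ p<q) , ≤-trans (<⇒≤ q<r) r≤b′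
      go lll₃ _ (b≤q , q≤b′) = ≤-trans b≤q (<⇒≤ q<r) , r≤b′ (<-≤-trans p<q q≤b′)

    lower-corners : ∀ {R w₁ w₂ w₃} → IsLowerRegion R → Corners R w₁ w₂ w₃ → IsLower w₁ × IsLower w₂ × IsLower w₃
    lower-corners isLower lll₁ = tt , tt , tt
    lower-corners isLower lll₂ = tt , tt , tt
    lower-corners isLower lll₃ = tt , tt , tt

    confined : ∀ {L} → Reached T (lower v) lowerTriangles L → ∀ w → IsLower w → Labelled L w → In w
    confined start (lower _) _ (_ , self) = <⇒≤ b<v , <⇒≤ v<b′
    confined start (lower x) _ (_ , joined {w = lower _} s refl) =
      ≮⇒≥ (λ x<b → —-noncrossing (fin x) (fin v) (fin b) ∞ x<b b<v tt (—-sym (fin v) (fin x) s) left) ,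
      ≮⇒≥ (λ b′<x → —-noncrossing (fin v) (fin x) (fin b′) ∞ v<b′ b′<x tt s right)
    confined (lowerStep r _ _) w isL (y , old l) = confined r w isL (y , l)
    confined (lowerStep r lowerR (sum {w₁} {w₂} t corners l₁ l₂ _)) (lower x) _ (_ , new {u = _} x≈w) with
        lower-corners lowerR corners
    ... | low₁ , low₂ , _ = transfer x≈w (corners-in lowerR t corners (confined r w₁ low₁ (_ , l₁))
        (confined r w₂ low₂ (_ , l₂)))
      where
      transfer : ∀ {w} → lower x ≈ w → In w → In (lower x)
      transfer {lower _} refl i = i

    -- The condition for `switch`: labelled lower vertices lie in the window, so the third corner
    -- does too, and the window is already filled.
    exhausted : ∀ {R w x} → IsLowerRegion R → ¬ Applicable T labelling R w x
    exhausted {w = w} lowerR (sum {w₁} {w₂} t corners l₁ l₂ ¬l) with lower-corners lowerR corners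
    ... | low₁ , low₂ , low = ¬l (inside w low
      (corners-in lowerR t corners (confined reached w₁ low₁ (_ , l₁)) (confined reached w₂ low₂ (_ , l₂))))
      where
      inside : ∀ w → IsLower w → In w → Labelled labelling w
      inside (lower x) _ (b≤x , x≤b′) = at filled b≤x x≤b′

    switched : Reached T (lower v) allTriangles labelling
    switched = switch reached exhausted

    all-upper : ∀ {φ L k} → Reached T (lower v) φ L → Labelled L (upper k) → ∀ l → Labelled L (upper l)
    all-upper r (y , l) k = y , Sound.saturated (reached-sound r) l refl

    label-upper : Extension allTriangles labelling λ L → ∀ k → Labelled L (upper k)
    label-upper with upper-vertex
    ... | inj₁ l = labelling , switched , id , l
    ... | inj₂ con with upperTriangle con
    ... | _ , three-sided , t with extend switched tt t llu₃ (at filled ≤-refl b≤b′) (at filled b≤b′ ≤-refl)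
      where b≤b′ = <⇒≤ (<-trans b<v v<b′)
    ... | L , r , k , l = L , r , k , all-upper r l
    label-upper | inj₂ con | _ , four-sided , t with extend switched tt t lluu₃ (at filled ≤-refl b≤b′)
        (at filled b≤b′ ≤-refl)
      where b≤b′ = <⇒≤ (<-trans b<v v<b′)
    ... | L , r , k , l = L , r , k , all-upper r l

    extend-right : ∀ {L c c′} → Reached T (lower v) allTriangles L → Consecutive c c′ → Labelled L (lower c) →
                   (∀ k → Labelled L (upper k)) → Extension allTriangles L λ L′ → Labelled L′ (lower c′)
    extend-right r con lc lu with upperTriangle con
    ... | _ , three-sided , t = extend r tt t llu₂ lc (lu _)
    ... | _ , four-sided , t = extend r tt t lluu₂ lc (lu _)

    -- From a bridging vertex and the upper boundary the next bridging vertex gets its label; once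
    -- `x` is passed, the polygon under that gap is filled. `d` bounds the distance left.
    walk : ∀ d {L c x} → Reached T (lower v) allTriangles L → Bridging c → Labelled L (lower c) →
           (∀ k → Labelled L (upper k)) → c ≤ x → x ≤ c + + d → Extension allTriangles L λ L′ →
               Labelled L′ (lower x)
    walk d {L} {c} {x} r bc lc lu c≤x x≤ with <-cmp c x
    ... | tri≈ _ refl _ = L , r , id , lc
    ... | tri> _ _ x<c = ⊥-elim (<⇒≱ x<c c≤x)
    walk ℕ.zero {c = c} {x} r bc lc lu c≤x x≤ | tri< c<x _ _ =
      ⊥-elim (<⇒≱ c<x (subst (x ≤_) (+-identityʳ c) x≤))
    walk (ℕ.suc d) {c = c} {x} r bc lc lu c≤x x≤ | tri< _ _ _ with consecutive-next bc
    ... | c′ , con with extend-right r con lc lu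
    ... | L₁ , r₁ , k₁ , l₁ with ≤-total c′ x
    ... | inj₁ c′≤x with walk d r₁ (Consecutive.right con) l₁ (k₁ ∘ lu) c′≤x
                           (≤-trans (subst (x ≤_) (i+suc-d c d) x≤) (+-monoˡ-≤ (+ d)
                               (i<j⇒i+1≤j (Consecutive.ordered con))))
    ... | L₂ , r₂ , k₂ , l₂ = L₂ , r₂ , k₂ ∘ k₁ , l₂
    walk (ℕ.suc d) r bc lc lu c≤x x≤ | tri< _ _ _ | c′ , con | L₁ , r₁ , k₁ , l₁ | inj₂ x≤c′
      with fill (consecutive-polygon con) r₁ (k₁ lc) l₁
    ... | L₂ , r₂ , k₂ , b₂ = L₂ , r₂ , k₂ ∘ k₁ , at b₂ c≤x x≤c′

    labelled-from-window : ∀ {x} → v ≤ x → ∃[ φ ] ∃[ L ] Reached T (lower v) φ L × Labelled L (lower x)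
    labelled-from-window {x} v≤x with ≤-total x b′
    ... | inj₁ x≤b′ = _ , _ , reached , at filled (≤-trans (<⇒≤ b<v) v≤x) x≤b′
    ... | inj₂ b′≤x with label-upper | i≤j⇒j≡i+d b′≤x
    ... | L , r , k , lu | d , refl with walk d r right (k (at filled (<⇒≤ (<-trans b<v v<b′)) ≤-refl)) lu b′≤x
        ≤-refl
    ... | L′ , r′ , _ , l = _ , L′ , r′ , l

  labelIs : ∀ {x} → v ≤ x → ∃[ y ] LabelIs T (lower v) (lower x) y × + y ≡ g x
  labelIs {x} v≤x with labelled-from-window (proj₂ (proj₂ window)) v≤x
  ... | φ , L , r , y , l = y , record
    { received = φ , L , r , l
    ; unique = λ r′ l′ → +-injective (trans (Sound.correct (reached-sound r′) l′)
        (sym (Sound.correct (reached-sound r) l)))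
    } , trans (Sound.correct (reached-sound r) l) (at-x (<-cmp v x))
    where
    at-x : Tri (v < x) (v ≡ x) (x < v) → label (fin x) ≡ g x
    at-x (tri< v<x _ _) = label-right (fin x) v<x
    at-x (tri≈ _ refl _) = trans label-self (sym g-v)
    at-x (tri> _ _ x<v) = ⊥-elim (<⇒≱ x<v v≤x)

-- Infinite friezes

module _ {m : ℤ → ℤ → ℤ} (frieze : IsInfiniteFrieze m) where
  open IsInfiniteFrieze frieze

  private
    i-1+1 : ∀ i → i - + 1 + + 1 ≡ i
    i-1+1 = solve-∀

  ones-above : ∀ i → m (i + + 1) i ≡ + 1
  ones-above i = trans (cong (m (i + + 1)) (lemma i)) (ones (i + + 1))
    where
    lemma : ∀ i → i ≡ i + + 1 - + 1
    lemma = solve-∀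

  entry-nonZero : ∀ i d → ℤ.NonZero (m (i + + 1) (i + + d))
  entry-nonZero i ℕ.zero = subst ℤ.NonZero (sym (trans (cong (m (i + + 1)) (+-identityʳ i)) (ones-above i))) _
  entry-nonZero i (ℕ.suc d) = ℤ.>-nonZero (positive (i + + 1) (i + + ℕ.suc d)
    (subst (i + + 1 ≤_) (sym (i+suc-d i d)) (i≤i+j (i + + 1) (+ d))))

  -- Adjacent rows have 2 by 2 determinants 1, and comparing two neighbouring diamonds passes the
  -- coefficient from row `i + 1` to row `i`, up to the factor `Y`, which is nonzero as an entry 1
  -- or a positive one. The induction starts at the boundary entries 0 and 1.
  three-term : ∀ d i j → j ≡ i - + 1 + + d → m i (j + + 1) + m i (j - + 1) ≡ m (j + + 1) (j + + 1) * m i j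
  three-term ℕ.zero i j refl = begin
    m i (i - + 1 + + 0 + + 1) + m i (i - + 1 + + 0 - + 1)   ≡⟨ cong₂ (λ x y → m i x + m i y) (l₁ i) (l₂ i) ⟩
    m i i + m i (i - + 2)                                   ≡⟨ cong (_+_ (m i i)) (zeros i) ⟩
    m i i + + 0                                             ≡⟨ l₃ (m i i) ⟩
    m i i * + 1
        ≡⟨ cong₂ (λ x y → m x x * y) (sym (l₁ i)) (sym (trans (cong (m i) (l₄ i)) (ones i))) ⟩
    m (i - + 1 + + 0 + + 1) (i - + 1 + + 0 + + 1) * m i (i - + 1 + + 0) ∎
    where
    open ≡-Reasoning
    l₁ : ∀ i → i - + 1 + + 0 + + 1 ≡ i
    l₁ = solve-∀
    l₂ : ∀ i → i - + 1 + + 0 - + 1 ≡ i - + 2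
    l₂ = solve-∀
    l₃ : ∀ x → x + + 0 ≡ x * + 1
    l₃ = solve-∀
    l₄ : ∀ i → i - + 1 + + 0 ≡ i - + 1
    l₄ = solve-∀
  three-term (ℕ.suc d) i j j≡ = *-cancelˡ-≡ Y _ _ (eliminate X Y Z x y z a diamond₁ diamond₂ step′)
    where
    a = m (j + + 1) (j + + 1)
    X = m (i + + 1) (j + + 1)
    Y = m (i + + 1) j
    Z = m (i + + 1) (j - + 1)
    x = m i (j + + 1)
    y = m i j
    z = m i (j - + 1)
    j≡i+d : j ≡ i + + d
    j≡i+d = trans j≡ (trans (i+suc-d (i - + 1) d) (cong (_+ + d) (i-1+1 i)))
    instance
      nonZero-Y : ℤ.NonZero Y
      nonZero-Y = subst (λ k → ℤ.NonZero (m (i + + 1) k)) (sym j≡i+d) (entry-nonZero i d)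
    step′ : X + Z ≡ a * Y
    step′ = three-term d (i + + 1) j (trans j≡i+d (cong (_+ + d) (lemma i)))
      where
      lemma : ∀ i → i ≡ i + + 1 - + 1
      lemma = solve-∀
    j-i≡d : j - i ≡ + d
    j-i≡d = trans (cong (_- i) j≡i+d) (lemma i (+ d))
      where
      lemma : ∀ i d → i + d - i ≡ d
      lemma = solve-∀
    -1≤ : - (+ 1) ≤ j - + 1 - i
    -1≤ = subst (- (+ 1) ≤_) (sym (trans (lemma j i) (cong (_- + 1) j-i≡d)))
        (+-monoˡ-≤ (- (+ 1)) {+ 0} {+ d} (+≤+ ℕ.z≤n))
      where
      lemma : ∀ j i → j - + 1 - i ≡ j - i - + 1
      lemma = solve-∀
    diamond₁ : y * X - Y * x ≡ + 1
    diamond₁ = diamond i j (subst (- (+ 1) ≤_) (sym j-i≡d) neg-≤-pos)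
    diamond₂ : z * Y - Z * y ≡ + 1
    diamond₂ = subst (λ k → z * m (i + + 1) k - Z * m i k ≡ + 1) (i-1+1 j) (diamond i (j - + 1) -1≤)
    eliminate : ∀ X Y Z x y z a → y * X - Y * x ≡ + 1 → z * Y - Z * y ≡ + 1 → X + Z ≡ a * Y →
                Y * (x + z) ≡ Y * (a * y)
    eliminate X Y Z x y z a e₁ e₂ e₃ = begin
      Y * (x + z)                                              ≡⟨ l₁ X Y Z x y z ⟩
      y * (X + Z) + ((z * Y - Z * y) - (y * X - Y * x))
          ≡⟨ cong₂ (λ u v → y * u + v) e₃ (cong₂ _-_ e₂ e₁) ⟩
      y * (a * Y) + (+ 1 - + 1)                                ≡⟨ l₂ y a Y ⟩
      Y * (a * y)                                              ∎
      where
      open ≡-Reasoning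
      l₁ : ∀ X Y Z x y z → Y * (x + z) ≡ y * (X + Z) + ((z * Y - Z * y) - (y * X - Y * x))
      l₁ = solve-∀
      l₂ : ∀ y a Y → y * (a * Y) + + 0 ≡ Y * (a * y)
      l₂ = solve-∀

-- Translation of frieze entries

periodic-shift : ∀ {n m} → IsPeriodicArray n m → ∀ i j k → i ≤ j → m i j ≡ m (i + k * + n) (j + k * + n)
periodic-shift {n} {m} per i j (+ d) i≤j = right-shift d i j i≤j
  where
  right-shift : ∀ d i j → i ≤ j → m i j ≡ m (i + + d * + n) (j + + d * + n)
  right-shift ℕ.zero i j _ = cong₂ m (lemma i) (lemma j)
    where
    lemma : ∀ x → x ≡ x + + 0
    lemma x = sym (+-identityʳ x)
  right-shift (ℕ.suc d) i j i≤j = trans (per i j i≤j) (trans (right-shift d _ _ (+-monoˡ-≤ (+ n) i≤j))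
    (cong₂ m (lemma i (+ n) (+ d)) (lemma j (+ n) (+ d))))
    where
    lemma : ∀ x n d → x + n + d * n ≡ x + (+ 1 + d) * n
    lemma = solve-∀
periodic-shift {n} {m} per i j k@(-[1+ d ]) i≤j =
  sym (trans (periodic-shift per (i + k * + n) (j + k * + n) (+ ℕ.suc d) (+-monoˡ-≤ (k * + n) i≤j))
             (cong₂ m (lemma i (+ n) (+ ℕ.suc d)) (lemma j (+ n) (+ ℕ.suc d))))
  where
  lemma : ∀ x n d → x + (- d) * n + d * n ≡ x
  lemma = solve-∀

-- Periodicity is assumed only for `i ≤ j`; the remaining entries are the boundary ones, constantly
-- 0 or 1.
frieze-shift : ∀ {n m} → IsInfiniteFrieze m → IsPeriodicArray n m → ∀ i j k → - (+ 2) ≤ j - i →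
               m i j ≡ m (i + k * + n) (j + k * + n)
frieze-shift {n} {m} frieze per i j k -2≤ with <-cmp i j
... | tri< i<j _ _ = periodic-shift per i j k (<⇒≤ i<j)
... | tri≈ _ refl _ = periodic-shift per i i k ≤-refl
... | tri> _ _ j<i = near (j≡i-2-or-i-1 (<-cmp (j + + 1) i))
  where
  open IsInfiniteFrieze frieze
  i-2≤j : i - + 2 ≤ j
  i-2≤j = subst₂ _≤_ (l₁ i) (l₂ i j) (+-monoʳ-≤ i -2≤)
    where
    l₁ : ∀ i → i + - (+ 2) ≡ i - + 2
    l₁ i = refl
    l₂ : ∀ i j → i + (j - i) ≡ j
    l₂ = solve-∀
  j≡i-2-or-i-1 : Tri (j + + 1 < i) (j + + 1 ≡ i) (i < j + + 1) → j ≡ i - + 2 ⊎ j ≡ i - + 1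
  j≡i-2-or-i-1 (tri> _ _ i<j+1) = ⊥-elim (<⇒≱ j<i (i<j+1⇒i≤j i<j+1))
  j≡i-2-or-i-1 (tri≈ _ eq _) = inj₂ (trans (lemma j) (cong (_- + 1) eq))
    where
    lemma : ∀ j → j ≡ j + + 1 - + 1
    lemma = solve-∀
  j≡i-2-or-i-1 (tri< j+1<i _ _) = inj₁ (≤-antisym
    (subst (_≤ i - + 2) (lemma j) (+-monoˡ-≤ (- (+ 2)) (i<j⇒i+1≤j j+1<i))) i-2≤j)
    where
    lemma : ∀ j → j + + 1 + + 1 - + 2 ≡ j
    lemma = solve-∀
  move : ∀ i c s → i + s - c ≡ i - c + s
  move = solve-∀
  near : j ≡ i - + 2 ⊎ j ≡ i - + 1 → m i j ≡ m (i + k * + n) (j + k * + n)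
  near (inj₁ refl) = trans (zeros i) (sym (trans (cong (m _) (sym (move i (+ 2) (k * + n))))
      (zeros (i + k * + n))))
  near (inj₂ refl) = trans (ones i) (sym (trans (cong (m _) (sym (move i (+ 1) (k * + n))))
      (ones (i + k * + n))))

diagonal-counts : ∀ {n} .{{_ : NonZero n}} {T m} → IsAssociatedFrieze n T m →
                  ∀ p → ∃[ c ] NumberOfTrianglesAt T (lower p) c × m p p ≡ + c
diagonal-counts {n} {T} {m} associated p =
  quiddity i ,
  subst (λ q → NumberOfTrianglesAt T (lower q) (quiddity i)) (sym p≡) (isQuiddity i k) ,
  trans (cong (λ q → m q q) p≡) (trans (sym (periodic-shift isPeriodic (index i) (index i) k ≤-refl))
      (diagonal i))
  where
  open IsAssociatedFrieze associated
  -- Dividing `p - 1` instead of `p` matches the remainders 0, ..., n - 1 with the vertex numbers 1,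
  -- ..., n.
  k = (p - + 1) /ℕ n
  i = fromℕ< (n%ℕd<d (p - + 1) n)
  p≡ : p ≡ index i + k * + n
  p≡ = begin
    p                                            ≡⟨ l₁ p ⟩
    + 1 + (p - + 1)                              ≡⟨ cong (_+_ (+ 1)) (a≡a%ℕn+[a/ℕn]*n (p - + 1) n) ⟩
    + 1 + (+ ((p - + 1) %ℕ n) + k * + n)         ≡⟨ sym (+-assoc (+ 1) (+ ((p - + 1) %ℕ n)) (k * + n)) ⟩
    + ℕ.suc ((p - + 1) %ℕ n) + k * + n
        ≡⟨ cong (λ r → + ℕ.suc r + k * + n) (sym (toℕ-fromℕ< (n%ℕd<d (p - + 1) n))) ⟩
    index i + k * + n                            ∎
    where
    open ≡-Reasoning
    l₁ : ∀ p → p ≡ + 1 + (p - + 1)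
    l₁ = solve-∀

-- Two-sided solution of the recurrence

module Recurrence (a : ℤ → ℤ) where

  -- The solution at `k` and at `- k`. The value - 1 of `backward 1` is forced by the recurrence at
  -- 0.
  forward backward : ℕ → ℤ
  forward 0 = + 0
  forward 1 = + 1
  forward (ℕ.suc (ℕ.suc k)) = a (+ ℕ.suc k) * forward (ℕ.suc k) - forward k
  backward 0 = + 0
  backward 1 = - (+ 1)
  backward (ℕ.suc (ℕ.suc k)) = a (-[1+ k ]) * backward (ℕ.suc k) - backward k

  solution : ℤ → ℤ
  solution (+ k)    = forward k
  solution -[1+ k ] = backward (ℕ.suc k)

  solution-neg : ∀ k → solution (- (+ k)) ≡ backward k
  solution-neg ℕ.zero = refl
  solution-neg (ℕ.suc k) = refl

  private
    cancel : ∀ x y → (x - y) + y ≡ x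
    cancel = solve-∀
    cancel′ : ∀ x y → y + (x - y) ≡ x
    cancel′ = solve-∀

  solves : ∀ z → solution (z + + 1) + solution (z - + 1) ≡ a z * solution z
  solves (+ 0) = sym (*-zeroʳ (a (+ 0)))
  solves (+ ℕ.suc k) = trans
    (cong (λ x → forward x + forward k) (ℕₚ.+-comm (ℕ.suc k) 1))
    (cancel (a (+ ℕ.suc k) * forward (ℕ.suc k)) (forward k))
  solves -[1+ k ] = trans
    (cong₂ (λ x y → x + backward y) (trans (cong solution (lemma (+ k))) (solution-neg k))
        (cong (ℕ.suc ∘ ℕ.suc) (ℕₚ.+-identityʳ k)))
    (cancel′ (a -[1+ k ] * backward (ℕ.suc k)) (backward k))
    where
    lemma : ∀ k → - (+ 1 + k) + + 1 ≡ - k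
    lemma = solve-∀

-- Frieze entries as labels

module LabelsAreEntries (n : ℕ) .{{nz : NonZero n}} (T : Rel Vertex 0ℓ) (m : ℤ → ℤ → ℤ)
  (periodic : IsPeriodicTriangulation n T) (associated : IsAssociatedFrieze n T m) (v : ℤ) where

  open IsAssociatedFrieze associated
  open IsInfiniteFrieze isInfiniteFrieze
  open Recurrence (λ z → m (v + z) (v + z))

  g : ℤ → ℤ
  g p = solution (p - v)

  recurrence : ∀ p → ∃[ c ] NumberOfTrianglesAt T (lower p) c × g (p + + 1) + g (p - + 1) ≡ + c * g p
  recurrence p with diagonal-counts associated p
  ... | c , number , mpp = c , number , (begin
    g (p + + 1) + g (p - + 1)
        ≡⟨ cong₂ (λ x y → solution x + solution y) (l₁ p v) (l₂ p v) ⟩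
    solution (p - v + + 1) + solution (p - v - + 1) ≡⟨ solves (p - v) ⟩
    m (v + (p - v)) (v + (p - v)) * g p             ≡⟨ cong (λ q → m q q * g p) (l₃ p v) ⟩
    m p p * g p                                     ≡⟨ cong (_* g p) mpp ⟩
    + c * g p                                       ∎)
    where
    open ≡-Reasoning
    l₁ : ∀ p v → p + + 1 - v ≡ p - v + + 1
    l₁ = solve-∀
    l₂ : ∀ p v → p - + 1 - v ≡ p - v - + 1
    l₂ = solve-∀
    l₃ : ∀ p v → v + (p - v) ≡ p
    l₃ = solve-∀

  g-v : g v ≡ + 0
  g-v = cong solution (+-inverseʳ v)

  g-v+1 : g (v + + 1) ≡ + 1
  g-v+1 = cong solution (lemma v)
    where
    lemma : ∀ v → v + + 1 - v ≡ + 1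
    lemma = solve-∀

  -- Both sides obey the same recurrence, and the initial values 0 and 1 are the boundary entries of
  -- row `v + 1`.
  forward-entry : ∀ d → forward d ≡ m (v + + 1) (v + + d - + 1)
  forward-entry 0 = sym (trans (cong (m (v + + 1)) (lemma v)) (zeros (v + + 1)))
    where
    lemma : ∀ v → v + + 0 - + 1 ≡ v + + 1 - + 2
    lemma = solve-∀
  forward-entry 1 = sym (ones (v + + 1))
  forward-entry (ℕ.suc (ℕ.suc d)) = begin
    m (v + + ℕ.suc d) (v + + ℕ.suc d) * forward (ℕ.suc d) - forward d
      ≡⟨ cong₂ (λ x y → m (v + + ℕ.suc d) (v + + ℕ.suc d) * x - y) (forward-entry (ℕ.suc d)) (forward-entry d) ⟩
    m (v + + ℕ.suc d) (v + + ℕ.suc d) * M (v + + ℕ.suc d - + 1) - M (v + + d - + 1)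
      ≡⟨ cong₂ (λ x y → m x x * M (v + + ℕ.suc d - + 1) - M y) (l₁ v (+ ℕ.suc d)) (l₂ v (+ d)) ⟩
    m (q + + 1) (q + + 1) * M q - M (q - + 1)
      ≡⟨ cong (_- M (q - + 1)) (sym (three-term isInfiniteFrieze d (v + + 1) q (l₃ v (+ d)))) ⟩
    (M (q + + 1) + M (q - + 1)) - M (q - + 1)
      ≡⟨ l₄ (M (q + + 1)) (M (q - + 1)) ⟩
    M (q + + 1)
      ≡⟨ cong M (l₅ v (+ ℕ.suc d)) ⟩
    M (v + + ℕ.suc (ℕ.suc d) - + 1) ∎
    where
    open ≡-Reasoning
    M : ℤ → ℤ
    M = m (v + + 1)
    q : ℤ
    q = v + + ℕ.suc d - + 1
    l₁ : ∀ v d → v + d ≡ v + d - + 1 + + 1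
    l₁ = solve-∀
    l₂ : ∀ v d → v + d - + 1 ≡ v + (+ 1 + d) - + 1 - + 1
    l₂ = solve-∀
    l₃ : ∀ v d → v + (+ 1 + d) - + 1 ≡ v + + 1 - + 1 + d
    l₃ = solve-∀
    l₄ : ∀ x y → (x + y) - y ≡ x
    l₄ = solve-∀
    l₅ : ∀ v d → v + d - + 1 + + 1 ≡ v + (+ 1 + d) - + 1
    l₅ = solve-∀

  g-entry : ∀ {w} → v ≤ w → g w ≡ m (v + + 1) (w - + 1)
  g-entry v≤w = let d , w≡v+d = i≤j⇒j≡i+d v≤w in at-distance d w≡v+d
    where
    lemma : ∀ v d → v + d - v ≡ d
    lemma = solve-∀
    at-distance : ∀ d {w} → w ≡ v + + d → g w ≡ m (v + + 1) (w - + 1)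
    at-distance d refl = trans (cong solution (lemma v (+ d))) (forward-entry d)

  label-is-entry : ∀ {w} → v ≤ w → ∃[ x ] LabelIs T (lower v) (lower w) x × m (v + + 1) (w - + 1) ≡ + x
  label-is-entry v≤w =
    let x , is-x , x≡g = Labelling.labelIs n T periodic g recurrence v g-v g-v+1 v≤w
    in x , is-x , sym (trans x≡g (g-entry v≤w))

theorem5p3 : (n : ℕ) .{{_ : NonZero n}} (T : Rel Vertex 0ℓ) (m : ℤ → ℤ → ℤ) →
    IsPeriodicTriangulation n T → IsAssociatedFrieze n T m →
    (i j k : ℤ) → - (+ 2) ≤ j - i →
    ∃[ x ] (LabelIs T (lowerVertex n (i - + 1) k) (lowerVertex n (j + + 1) k) x × m i j ≡ + x)
theorem5p3 n T m periodic associated i j k -2≤j-i =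
  let x , is-x , entry≡x = LabelsAreEntries.label-is-entry n T m periodic associated (i - + 1 + k * + n) v≤w
  -- The label is computed at vertices moved by `k n`; periodicity brings the entry back to `i`,
  -- `j`.
  in x , is-x , trans (frieze-shift isInfiniteFrieze isPeriodic i j k -2≤j-i)
                      (trans (sym (cong₂ m (above i (k * + n)) (below j (k * + n)))) entry≡x)
  where
  open IsAssociatedFrieze associated
  difference : ∀ i j s → + 2 + (j - i) ≡ (j + + 1 + s) - (i - + 1 + s)
  difference = solve-∀
  -- The two vertices are `j - i + 2` apart, so the bound - 2 says exactly that the target is not to
  -- the left of the start.
  v≤w : i - + 1 + k * + n ≤ j + + 1 + k * + n
  v≤w = 0≤i-j⇒j≤i (subst (+ 0 ≤_) (difference i j (k * + n)) (+-monoʳ-≤ (+ 2) -2≤j-i))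
  above : ∀ i s → i - + 1 + s + + 1 ≡ i + s
  above = solve-∀
  below : ∀ j s → j + + 1 + s - + 1 ≡ j + s
  below = solve-∀
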